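{- Let $T$ be a tree, let $I, J$ be two $k$-path vertex covers of $T$, and let $u$ be a positive integer. Then one can decide in polynomial time whether $I$ and $J$ are reconfigurable under $\mathsf{TAR}(u)$.
   Context: Fix an integer $k \geq 2$. A $k$-path is a path on $k$ vertices. A vertex subset $I \subseteq V(G)$ is a $k$-path vertex cover of $G$ if every $k$-path in $G$ contains at least one vertex of $I$. For a positive integer $u$, a sequence $\langle I_0, \dots, I_\ell \rangle$ of $k$-path vertex covers of $G$ is a $\mathsf{TAR}(u)$-sequence between $I_0$ and $I_\ell$ if $|I_i| \le u$ for all $i$ and $|I_i \Delta I_{i+1}| = 1$ for each $i<\ell$. $I$ and $J$ are reconfigurable under $\mathsf{TAR}(u)$ if such a sequence exists between them. -}

module Defs where

open import Data.Bool.Base using (Bool; true; false)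
open import Data.Fin.Base using (Fin; zero)
open import Data.Fin.Subset using (Subset; _∈_; _∉_; _∪_; _─_; ∣_∣)
open import Data.Nat.Base using (ℕ; suc; _+_; _*_; _^_; _≤_)
open import Data.Nat.Binary.Base as ℕᵇ using (ℕᵇ; 2[1+_]; 1+[2_])
open import Data.Product.Base using (_×_; ∃-syntax)
open import Data.Vec.Base using (Vec; []; _∷_; head; last; lookup; replicate; tabulate; _[_]≔_)
open import Data.Vec.Relation.Unary.All using (All)
open import Data.Vec.Relation.Unary.Any using (Any)
open import Data.Vec.Relation.Unary.Linked using (Linked)
open import Data.Vec.Relation.Unary.Unique.Propositional using (Unique)
open import Relation.Binary.Construct.Closure.ReflexiveTransitive using (Star)
open import Relation.Binary.PropositionalEquality.Core using (_≡_)
open import Relation.Nullary.Negation.Core using (¬_)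
open import Relation.Nullary.Reflects using (Reflects)

------------------------------------------------------------------------
-- Graphs and trees

record Graph (n : ℕ) : Set where
  field
    N      : Fin n → Subset n
    sym    : ∀ {v w} → w ∈ N v → v ∈ N w
    irrefl : ∀ {v} → v ∉ N v

  _~_ : Fin n → Fin n → Set
  v ~ w = w ∈ N v

  -- Paths are given by their vertices in order; a k-path has k vertices
  -- (not k edges).
  IsPath : ∀ {k} → Vec (Fin n) k → Set
  IsPath p = Linked _~_ p × Unique p

  Connected : Set
  Connected = ∀ v w → Star _~_ v w

  -- A cycle is a path on at least three vertices with adjacent ends.
  Acyclic : Set
  Acyclic = ∀ {m} (p : Vec (Fin n) (3 + m)) → IsPath p → ¬ (last p ~ head p)

record IsTree {n} (G : Graph n) : Set where
  open Graph G
  field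
    nonempty  : 1 ≤ n
    connected : Connected
    acyclic   : Acyclic

------------------------------------------------------------------------
-- Path vertex covers and their reconfiguration

IsPathVertexCover : ∀ {n} → ℕ → Graph n → Subset n → Set
IsPathVertexCover {n} k G I = (p : Vec (Fin n) k) → Graph.IsPath G p → Any (_∈ I) p

_△_ : ∀ {n} → Subset n → Subset n → Subset n
A △ B = (A ─ B) ∪ (B ─ A)

record IsTARSequence {n ℓ} (k : ℕ) (G : Graph n) (u : ℕ) (I J : Subset n)
                     (Is : Vec (Subset n) (suc ℓ)) : Set where
  field
    covers : All (IsPathVertexCover k G) Is
    sizes  : All (λ A → ∣ A ∣ ≤ u) Is
    steps  : Linked (λ A B → ∣ A △ B ∣ ≡ 1) Is
    start  : head Is ≡ I
    end    : last Is ≡ J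

TAR-Reconfigurable : ∀ {n} → ℕ → Graph n → ℕ → Subset n → Subset n → Set
TAR-Reconfigurable {n} k G u I J =
  ∃[ ℓ ] ∃[ Is ] IsTARSequence {n} {ℓ} k G u I J Is

------------------------------------------------------------------------
-- Polynomial time

-- The machine model is the imperative language WHILE on binary trees of
-- N. D. Jones, "Computability and Complexity", with his time measure
-- (every evaluated operation costs one unit).  As `cons` shares its
-- arguments and trees are only inspected through `hd`, `tl` and tests
-- for `nil`, its polynomial-time decidable problems are exactly those of
-- Turing machines.

infixr 5 _∙_

data 𝔻 : Set where
  nil : 𝔻
  _∙_ : 𝔻 → 𝔻 → 𝔻

size : 𝔻 → ℕ
size nil     = 1
size (a ∙ b) = suc (size a + size b)

car cdr : 𝔻 → 𝔻
car nil     = nil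
car (a ∙ b) = a
cdr nil     = nil
cdr (a ∙ b) = b

data Expr (m : ℕ) : Set where
  var   : Fin m → Expr m
  nil   : Expr m
  cons  : Expr m → Expr m → Expr m
  hd tl : Expr m → Expr m

Store : ℕ → Set
Store m = Vec 𝔻 m

eval : ∀ {m} → Expr m → Store m → 𝔻
eval (var x)    s = lookup s x
eval nil        s = nil
eval (cons e f) s = eval e s ∙ eval f s
eval (hd e)     s = car (eval e s)
eval (tl e)     s = cdr (eval e s)

cost : ∀ {m} → Expr m → ℕ
cost (var x)    = 1
cost nil        = 1
cost (cons e f) = suc (cost e + cost f)
cost (hd e)     = suc (cost e)
cost (tl e)     = suc (cost e)

infixr 4 _⨾_
infix  5 _≔_

data Cmd (m : ℕ) : Set where
  _≔_           : Fin m → Expr m → Cmd m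
  _⨾_           : Cmd m → Cmd m → Cmd m
  if_then_else_ : Expr m → Cmd m → Cmd m → Cmd m
  while_loop_   : Expr m → Cmd m → Cmd m

-- ⟨ C , s ⟩⇓ s′ in-time t: started in store s, the command C halts in
-- store s′ after t units of time.  In tests, nil is false and all other
-- trees are true.
data ⟨_,_⟩⇓_in-time_ {m} : Cmd m → Store m → Store m → ℕ → Set where

  assign : ∀ {x e s} →
           ⟨ x ≔ e , s ⟩⇓ (s [ x ]≔ eval e s) in-time suc (cost e)

  seq : ∀ {C D s s′ s″ t t′} →
        ⟨ C , s ⟩⇓ s′ in-time t →
        ⟨ D , s′ ⟩⇓ s″ in-time t′ →
        ⟨ C ⨾ D , s ⟩⇓ s″ in-time (t + t′)

  if-true : ∀ {e C D s s′ a b t} →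
            eval e s ≡ a ∙ b →
            ⟨ C , s ⟩⇓ s′ in-time t →
            ⟨ if e then C else D , s ⟩⇓ s′ in-time suc (cost e + t)

  if-false : ∀ {e C D s s′ t} →
             eval e s ≡ nil →
             ⟨ D , s ⟩⇓ s′ in-time t →
             ⟨ if e then C else D , s ⟩⇓ s′ in-time suc (cost e + t)

  while-true : ∀ {e C s s′ s″ a b t t′} →
               eval e s ≡ a ∙ b →
               ⟨ C , s ⟩⇓ s′ in-time t →
               ⟨ while e loop C , s′ ⟩⇓ s″ in-time t′ →
               ⟨ while e loop C , s ⟩⇓ s″ in-time suc (cost e + (t + t′))

  while-false : ∀ {e C s} →
                eval e s ≡ nil →
                ⟨ while e loop C , s ⟩⇓ s in-time suc (cost e)

-- Variable zero holds the input at the start and the output at the end;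
-- the m work variables are initially nil.
record Program : Set where
  constructor program
  field
    m    : ℕ
    body : Cmd (suc m)

  Computes : 𝔻 → 𝔻 → ℕ → Set
  Computes input output t =
    ∃[ s ] ⟨ body , input ∷ replicate m nil ⟩⇓ s in-time t × head s ≡ output

encodeBool : Bool → 𝔻
encodeBool false = nil
encodeBool true  = nil ∙ nil

-- A problem consists of the admissible instances X, their encoding and the
-- yes-instances P.  One program, with one polynomial time bound in the size
-- of the encoded input, has to answer correctly on every instance in X; its
-- behaviour on trees that encode no instance is unconstrained.
DecidableInPolynomialTime : (X : Set) → (X → 𝔻) → (X → Set) → Set
DecidableInPolynomialTime X encode P =
  ∃[ prog ] ∃[ c ] ∃[ d ] ∀ (x : X) →
    ∃[ answer ] ∃[ t ]
      Program.Computes prog (encode x) (encodeBool answer) t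
      × Reflects (P x) answer
      × t ≤ c * size (encode x) ^ d + c

------------------------------------------------------------------------
-- The instances for a fixed k

record Instance (k : ℕ) : Set where
  field
    n          : ℕ
    T          : Graph n
    T-tree     : IsTree T
    I J        : Subset n
    I-cover    : IsPathVertexCover k T I
    J-cover    : IsPathVertexCover k T J
    u          : ℕ
    u-positive : 1 ≤ u

encodeVec : ∀ {A : Set} {n} → (A → 𝔻) → Vec A n → 𝔻
encodeVec f []       = nil
encodeVec f (x ∷ xs) = f x ∙ encodeVec f xs

encodeSubset : ∀ {n} → Subset n → 𝔻
encodeSubset = encodeVec encodeBool

-- Bijective base-2 notation, least significant digit first; the size is
-- logarithmic in the encoded number.
encodeℕᵇ : ℕᵇ → 𝔻
encodeℕᵇ ℕᵇ.zero  = nil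
encodeℕᵇ 1+[2 x ] = encodeBool false ∙ encodeℕᵇ x
encodeℕᵇ 2[1+ x ] = encodeBool true ∙ encodeℕᵇ x

-- The adjacency matrix, the two covers as bit vectors, and u in binary.
encodeInstance : ∀ {k} → Instance k → 𝔻
encodeInstance x =
  encodeVec encodeSubset (tabulate N) ∙ encodeSubset I ∙ encodeSubset J ∙ encodeℕᵇ (ℕᵇ.fromℕ u)
  where
  open Instance x
  open Graph T using (N)

{-# OPTIONS --safe #-}
module Submission where

-- If I is a minimal cover of size u, no step leaves I; every other cover of
-- size at most u can be shrunk below u.  So I and J are reconfigurable iff
-- both have size at most u and either I = J or neither of them is stuck in
-- this way, provided that any two covers of size less than u are
-- reconfigurable.
--
-- For the latter, choose a vertex v and a branch B hanging from v such that
-- B ∪ {v} contains a k-path and B does not.  Every k-path that meets B then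
-- passes through v.  A cover meets B ∪ {v}, so one may add v and then delete
-- all vertices of B without ever needing more than one extra vertex.
-- Repeating this on the rest of the tree leads every cover to one and the
-- same canonical cover.
--
-- For fixed k, whether a cover is minimal is a first-order property of the
-- instance, and evaluating a fixed first-order formula takes polynomial time.

open import Defs
open import Data.Bool.Base using (Bool; true; false)
open import Data.Empty using (⊥-elim)
open import Data.Fin.Base using (Fin; zero; suc; toℕ; fromℕ<; _↑ˡ_; _↑ʳ_)
open import Data.Fin.Properties using (_≟_; any?; toℕ<n; toℕ-fromℕ<; toℕ-injective)
open import Data.Fin.Subset
  using (Subset; inside; outside; _∈_; _∉_; _⊆_; _⊂_; _⊃_; _─_; ⊥; ⊤; ∣_∣)
open import Data.Fin.Subset.Induction using (⊂-wellFounded; ⊃-wellFounded)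
open import Data.Fin.Subset.Properties
  using (_∈?_; ∉⊥; ∈⊤; ∣p∣≤n; p⊂q⇒∣p∣<∣q∣; p⊆q⇒∣p∣≤∣q∣; ⊆-antisym; ∪-comm)
open import Data.Nat.Base
  using (ℕ; zero; suc; pred; _+_; _*_; _^_; _∸_; _≤_; _<_; z≤n; s≤s; ⌈_/2⌉)
open import Data.Nat.Binary.Base as ℕᵇ using (ℕᵇ; 2[1+_]; 1+[2_])
import Data.Nat.Binary.Properties as ℕᵇ
import Data.Nat.Properties as ℕ
open import Data.Product.Base using (Σ; _×_; _,_; proj₁; proj₂; ∃-syntax)
open import Data.Product.Function.NonDependent.Propositional using (_×-⇔_)
open import Data.Sum.Base using (_⊎_; inj₁; inj₂; [_,_]′)
open import Data.Sum.Function.Propositional using (_⊎-⇔_)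
open import Data.Unit.Base using (tt) renaming (⊤ to Unit)
open import Data.Vec.Base
  using (Vec; []; _∷_; head; last; lookup; map; tabulate; _++_; _[_]≔_; here; there)
open import Data.Vec.Properties
  using (lookup∘tabulate; lookup⇒[]=; []=⇒lookup; lookup-++ˡ; lookup-++ʳ;
         tabulate-∘; tabulate-cong; tabulate∘lookup)
open import Data.Vec.Relation.Unary.All as All using (All; []; _∷_)
open import Data.Vec.Relation.Unary.AllPairs as AllPairs using ([]; _∷_)
open import Data.Vec.Relation.Unary.Any as Any using (Any; here; there)
open import Data.Vec.Relation.Unary.Linked as Linked using (Linked; []; [-]; _∷_)
open import Data.Vec.Relation.Unary.Unique.Propositional using (Unique)
open import Function.Base using (_∘_; id)
open import Function.Bundles using (_⇔_; mk⇔; Equivalence)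
open import Function.Properties.Equivalence using () renaming (refl to ⇔-refl; trans to ⇔-trans)
open import Function.Related.TypeIsomorphisms using (¬-cong-⇔)
open import Induction.WellFounded using (Acc; acc)
open import Relation.Binary.Construct.Closure.ReflexiveTransitive as Star using (Star; ε; _◅_; _◅◅_)
open import Relation.Binary.PropositionalEquality
  using (_≡_; _≢_; refl; sym; trans; cong; cong₂; subst)
open import Relation.Nullary using (¬_; Dec; yes; no; does; contradiction)
open import Relation.Nullary.Decidable using (¬?; _×-dec_; _⊎-dec_; map′; dec-true; decidable-stable)
open import Relation.Nullary.Reflects
  using (Reflects; ofʸ; ofⁿ; ¬-reflects; _×-reflects_; _⊎-reflects_)
open import Relation.Unary using (Decidable)

open Equivalence using (to; from)

-- Decidable subsets and auxiliary facts on vectors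

⟪_⟫ : ∀ {n} {P : Fin n → Set} → Decidable P → Subset n
⟪ P? ⟫ = tabulate (does ∘ P?)

module _ {n} {P : Fin n → Set} (P? : Decidable P) where

  ∈⟪⟫⁺ : ∀ {x} → P x → x ∈ ⟪ P? ⟫
  ∈⟪⟫⁺ {x} px = lookup⇒[]= x _ (trans (lookup∘tabulate _ x) (dec-true (P? x) px))

  ∈⟪⟫⁻ : ∀ {x} → x ∈ ⟪ P? ⟫ → P x
  ∈⟪⟫⁻ {x} x∈ with P? x | trans (sym (lookup∘tabulate (does ∘ P?) x)) ([]=⇒lookup x∈)
  ... | yes px | _ = px

anyVec? : ∀ {n} k {P : Vec (Fin n) k → Set} → Decidable P → Dec (∃[ p ] P p)
anyVec? zero    P? = map′ ([] ,_) (λ { ([] , p) → p }) (P? [])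
anyVec? (suc k) P? =
  map′ (λ (x , p , q) → x ∷ p , q) (λ { (x ∷ p , q) → x , p , q })
    (any? λ x → anyVec? k λ p → P? (x ∷ p))

without? : ∀ {n} (C : Subset n) v → Decidable λ x → x ∈ C × x ≢ v
without? C v x = (x ∈? C) ×-dec ¬? (x ≟ v)

without-split : ∀ {n} {C : Subset n} {v x} → x ∈ C → x ∈ ⟪ without? C v ⟫ ⊎ x ≡ v
without-split {C = C} {v} {x} x∈C with x ≟ v
... | yes x≡v = inj₂ x≡v
... | no  x≢v = inj₁ (∈⟪⟫⁺ (without? C v) (x∈C , x≢v))

¬Any⇒All¬ : ∀ {A : Set} {P : A → Set} {m} (xs : Vec A m) → ¬ Any P xs → All (λ x → ¬ P x) xs
¬Any⇒All¬ []       _  = []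
¬Any⇒All¬ (x ∷ xs) ¬a = (¬a ∘ here) ∷ ¬Any⇒All¬ xs (¬a ∘ there)

∷-linked : ∀ {A : Set} {R : A → A → Set} {m x} {xs : Vec A (suc m)} →
           R x (head xs) → Linked R xs → Linked R (x ∷ xs)
∷-linked = _∷_

-- Branches of a forest

module _ {n} (G : Graph n) where
  open Graph G renaming (sym to ~-sym)

  -- D separates w from v after the deletion of the edge vw.
  record Bridge (v w : Fin n) (D : Subset n) : Set where
    field
      w∈D    : w ∈ D
      v∉D    : v ∉ D
      closed : ∀ {x y} → x ∈ D → x ~ y → y ∈ D ⊎ (x ≡ w × y ≡ v)

  PathTo : Fin n → Subset n → Fin n → Set
  PathTo w D x = ∃[ m ] Σ (Vec (Fin n) (suc m)) λ p →
    IsPath p × All (_∈ D) p × head p ≡ x × last p ≡ w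

  module _ (acyclic : Acyclic) where

    -- A nontrivial path from `x` to `w` inside `D` would form a cycle together with the edges
    -- `x ~ v` and `v ~ w`.
    no-shortcut : ∀ {v w x D} → v ~ w → v ∉ D → PathTo w D x → x ~ v → x ≡ w
    no-shortcut v~w v∉D (_ , x ∷ [] , _ , _ , refl , e) x~v = e
    no-shortcut {v} {w} v~w v∉D (_ , x ∷ y ∷ p , (l , u) , i , refl , e) x~v =
      ⊥-elim (acyclic (v ∷ x ∷ y ∷ p)
        ( ~-sym x~v ∷ l
        , All.map (λ { z∈D refl → v∉D z∈D }) i ∷ u)
        (subst (_~ v) (sym e) (~-sym v~w)))

    -- The paths to w inside D are simple for free, as each new vertex is added in
    -- front of a path in the old D; reaching v in this way would close a cycle.
    grow : ∀ {v w} → v ~ w → (D : Subset n) → Acc _⊃_ D →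
           w ∈ D → v ∉ D → (∀ {x} → x ∈ D → PathTo w D x) → ∃[ D ] Bridge v w D
    grow {v} {w} v~w D (acc rec) w∈D v∉D paths
      with (any? λ x → any? λ y →
              (x ∈? D) ×-dec (y ∈? N x) ×-dec ¬? (y ∈? D) ×-dec ¬? ((x ≟ w) ×-dec (y ≟ v)))
    ... | no ¬exit = D , record
      { w∈D = w∈D ; v∉D = v∉D
      ; closed = λ {x} {y} x∈D x~y → decidable-stable ((y ∈? D) ⊎-dec ((x ≟ w) ×-dec (y ≟ v)))
          λ ¬c → ¬exit (x , y , x∈D , x~y , (λ i → ¬c (inj₁ i)) , λ i → ¬c (inj₂ i)) }
    ... | yes (x , y , x∈D , x~y , y∉D , ¬vw) =
      grow v~w D⁺ (rec (D⊆D⁺ , y , ∈⟪⟫⁺ D⁺? (inj₂ refl) , y∉D)) (D⊆D⁺ w∈D)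
        (λ v∈D⁺ → [ v∉D , (λ { refl → ¬vw (no-shortcut v~w v∉D (paths x∈D) x~y , refl) }) ]′
                    (∈⟪⟫⁻ D⁺? v∈D⁺))
        λ z∈D⁺ → path (∈⟪⟫⁻ D⁺? z∈D⁺)
      where
      D⁺? : Decidable λ z → z ∈ D ⊎ z ≡ y
      D⁺? z = (z ∈? D) ⊎-dec (z ≟ y)

      D⁺ : Subset n
      D⁺ = ⟪ D⁺? ⟫

      D⊆D⁺ : D ⊆ D⁺
      D⊆D⁺ z∈D = ∈⟪⟫⁺ D⁺? (inj₁ z∈D)

      path : ∀ {z} → z ∈ D ⊎ z ≡ y → PathTo w D⁺ z
      path (inj₁ z∈D) with paths z∈D
      ... | m , p , isPath , inD , h , l = m , p , isPath , All.map D⊆D⁺ inD , h , l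
      path (inj₂ refl) with paths x∈D
      ... | m , p , (lk , u) , inD , refl , l =
        suc m , y ∷ p
        , (∷-linked (~-sym x~y) lk , All.map (λ { z∈D refl → y∉D z∈D }) inD ∷ u)
        , (∈⟪⟫⁺ D⁺? (inj₂ refl) ∷ All.map D⊆D⁺ inD) , refl , l

    bridge : ∀ {v w} → v ~ w → ∃[ D ] Bridge v w D
    bridge {v} {w} v~w = grow v~w ⟪ _≟ w ⟫ (⊃-wellFounded _) (∈⟪⟫⁺ (_≟ w) refl)
      (λ v∈ → irrefl (subst (_~ w) (∈⟪⟫⁻ (_≟ w) v∈) v~w))
      λ x∈ → 0 , w ∷ [] , ([-] , [] ∷ []) , ∈⟪⟫⁺ (_≟ w) refl ∷ [] , sym (∈⟪⟫⁻ (_≟ w) x∈) , refl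

    -- Made total by a dummy set for non-adjacent vertices, so that decidable predicates can mention
    -- it without a proof of adjacency.
    side : ∀ v w → ∃[ D ] (v ~ w → Bridge v w D)
    side v w with w ∈? N v
    ... | yes v~w = proj₁ (bridge v~w) , λ _ → proj₂ (bridge v~w)
    ... | no ¬v~w = ⊥ , λ v~w → contradiction v~w ¬v~w

  -- Membership in `B` spreads along the path in both directions, since the closure condition
  -- applies to either end of an edge inside `S`.
  linked-closed : ∀ {S B : Subset n} → (∀ {x y} → x ∈ B → y ∈ S → x ~ y → y ∈ B) →
                  ∀ {m} {p : Vec (Fin n) m} → Linked _~_ p → All (_∈ S) p →
                  Any (_∈ B) p → All (_∈ B) p
  linked-closed cl [-] _ (here x∈B) = x∈B ∷ []
  linked-closed cl (_∷_ {xs = _ ∷ _} x~y l) (_ ∷ i@(y∈S ∷ _)) (here x∈B) =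
    x∈B ∷ linked-closed cl l i (here (cl x∈B y∈S x~y))
  linked-closed cl (_∷_ {xs = _ ∷ _} x~y l) (x∈S ∷ i) (there a) with linked-closed cl l i a
  ... | y∈B ∷ b = cl y∈B x∈S (~-sym x~y) ∷ y∈B ∷ b

  -- Equivalently, `B` is a union of components of the graph induced on `W` without `v`.
  record Branch (W : Subset n) (v : Fin n) (B : Subset n) : Set where
    field
      v∈W    : v ∈ W
      B⊆W    : B ⊆ W
      v∉B    : v ∉ B
      closed : ∀ {x y} → x ∈ B → y ∈ W → x ~ y → y ∈ B ⊎ y ≡ v

  module _ (k : ℕ) where

    PathWithin : (Fin n → Set) → Set
    PathWithin P = Σ (Vec (Fin n) k) λ p → IsPath p × All P p

    pathWithin? : ∀ {P} → Decidable P → Dec (PathWithin P)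
    pathWithin? P? = anyVec? k λ p →
      (Linked.linked? (λ x y → y ∈? N x) p ×-dec AllPairs.allPairs? (λ x y → ¬? (x ≟ y)) p)
      ×-dec All.all? P? p

  module _ (acyclic : Acyclic) {k : ℕ} (W : Subset n) where

    -- C contains the component of r in B, and v has no neighbour in C except
    -- possibly v′; so C without v′ is again a branch.
    record SubBranch (v : Fin n) (B : Subset n) (r : Fin n) : Set where
      field
        v′       : Fin n
        C        : Subset n
        v′∈C     : v′ ∈ C
        r∈C      : r ∈ C
        C⊆B      : C ⊆ B
        closed   : ∀ {x y} → x ∈ C → y ∈ B → x ~ y → y ∈ C
        attached : ∀ {x} → x ∈ C → x ~ v → x ≡ v′

    -- If `r` lies beyond some neighbour `w` of `v` in `B`, the part of `B` on that side of the edge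
    -- contains no neighbour of `v` but `w`. Otherwise the vertices of `B` beyond no such neighbour
    -- include `r`, and none of them is adjacent to `v`, so `r` itself can serve as `v′`.
    subBranch : ∀ {v B r} → Branch W v B → r ∈ B → SubBranch v B r
    subBranch {v} {B} {r} br r∈B
      with (any? λ w → (w ∈? B) ×-dec (w ∈? N v) ×-dec (r ∈? proj₁ (side acyclic v w)))
    ... | yes (w , w∈B , v~w , r∈D) = record
      { v′ = w ; C = ⟪ C? ⟫
      ; v′∈C = ∈⟪⟫⁺ C? (w∈B , D.w∈D)
      ; r∈C = ∈⟪⟫⁺ C? (r∈B , r∈D)
      ; C⊆B = λ x∈C → proj₁ (∈⟪⟫⁻ C? x∈C)
      ; closed = λ x∈C y∈B x~y → ∈⟪⟫⁺ C? (y∈B ,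
          [ id , (λ { (refl , refl) → contradiction y∈B (Branch.v∉B br) }) ]′
            (D.closed (proj₂ (∈⟪⟫⁻ C? x∈C)) x~y))
      ; attached = λ x∈C x~v → [ (λ v∈D → contradiction v∈D D.v∉D) , proj₁ ]′
          (D.closed (proj₂ (∈⟪⟫⁻ C? x∈C)) x~v)
      }
      where
      D : Subset n
      D = proj₁ (side acyclic v w)
      module D = Bridge (proj₂ (side acyclic v w) v~w)
      C? : Decidable λ x → x ∈ B × x ∈ D
      C? x = (x ∈? B) ×-dec (x ∈? D)
    ... | no ¬w = record
      { v′ = r ; C = ⟪ C? ⟫
      ; v′∈C = r∈C ; r∈C = r∈C
      ; C⊆B = λ x∈C → proj₁ (∈⟪⟫⁻ C? x∈C)
      ; closed = λ {x} {y} x∈C y∈B x~y → ∈⟪⟫⁺ C? (y∈B , λ (w , w∈B , v~w , y∈D) →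
          [ (λ x∈D → proj₂ (∈⟪⟫⁻ C? x∈C) (w , w∈B , v~w , x∈D))
          , (λ { (_ , refl) → Branch.v∉B br (proj₁ (∈⟪⟫⁻ C? x∈C)) })
          ]′ (Bridge.closed (proj₂ (side acyclic v w) v~w) y∈D (~-sym x~y)))
      ; attached = λ {x} x∈C x~v → contradiction
          (x , proj₁ (∈⟪⟫⁻ C? x∈C) , ~-sym x~v
             , Bridge.w∈D (proj₂ (side acyclic v x) (~-sym x~v)))
          (proj₂ (∈⟪⟫⁻ C? x∈C))
      }
      where
      C? : Decidable λ x → x ∈ B ×
             ¬ (∃[ w ] (w ∈ B × v ~ w × x ∈ proj₁ (side acyclic v w)))
      C? x = (x ∈? B) ×-dec
        ¬? (any? λ w → (w ∈? B) ×-dec (w ∈? N v) ×-dec (x ∈? proj₁ (side acyclic v w)))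
      r∈C : r ∈ ⟪ C? ⟫
      r∈C = ∈⟪⟫⁺ C? (r∈B , ¬w)

    -- Taking `v′` out of the sub-branch leaves a smaller branch at `v′`: an edge back to the old
    -- `v` could only start at `v′`. The path meets the sub-branch in `r` and cannot leave it inside
    -- `B`.
    narrow : ∀ {v B r} → Branch W v B → r ∈ B →
             ∀ {p : Vec (Fin n) k} → Linked _~_ p → Any (_≡ r) p → All (_∈ B) p →
             ∃[ v′ ] ∃[ B′ ] (Branch W v′ B′ × B′ ⊂ B × All (λ x → x ≡ v′ ⊎ x ∈ B′) p)
    narrow {v} {B} br r∈B l r∈p p⊆B =
      v′ , ⟪ B′? ⟫ ,
      record
        { v∈W = Branch.B⊆W br (C⊆B v′∈C)
        ; B⊆W = λ x∈B′ → Branch.B⊆W br (B′⊆B x∈B′)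
        ; v∉B = λ v′∈B′ → proj₂ (∈⟪⟫⁻ B′? v′∈B′) refl
        ; closed = λ {x} {y} x∈B′ y∈W x~y → let (x∈C , x≢v′) = ∈⟪⟫⁻ B′? x∈B′ in
            [ (λ y∈B → without-split (closed x∈C y∈B x~y))
            , (λ { refl → contradiction (attached x∈C x~y) x≢v′ })
            ]′ (Branch.closed br (B′⊆B x∈B′) y∈W x~y)
        } ,
      (B′⊆B , v′ , C⊆B v′∈C , λ v′∈B′ → proj₂ (∈⟪⟫⁻ B′? v′∈B′) refl) ,
      All.map (λ x∈C → [ inj₂ , inj₁ ]′ (without-split x∈C))
        (linked-closed closed l p⊆B (Any.map (λ { refl → r∈C }) r∈p))
      where
      open SubBranch (subBranch br r∈B)
      B′? : Decidable λ x → x ∈ C × x ≢ v′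
      B′? = without? C v′
      B′⊆B : ⟪ B′? ⟫ ⊆ B
      B′⊆B x∈B′ = C⊆B (proj₁ (∈⟪⟫⁻ B′? x∈B′))

    record Pendant : Set where
      field
        v       : Fin n
        B       : Subset n
        v∈W     : v ∈ W
        B⊆W     : B ⊆ W
        v∉B     : v ∉ B
        path    : PathWithin k (λ x → x ≡ v ⊎ x ∈ B)
        through : ∀ {p : Vec (Fin n) k} → IsPath p → All (_∈ W) p → Any (_∈ B) p → Any (v ≡_) p

    -- As long as `B` contains a k-path, narrow towards it; `B` shrinks strictly, so this stops.
    -- Then a k-path in `W` that meets `B` and avoids `v` would be confined to `B`, which contains
    -- none.
    descend : ∀ {v B} → 1 ≤ k → Acc _⊂_ B → Branch W v B →
              PathWithin k (λ x → x ≡ v ⊎ x ∈ B) → Pendant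
    descend {v} {B} k≥1 (acc rec) br path with pathWithin? k (_∈? B)
    descend _ (acc rec) br path | yes (p@(r ∷ _) , isPath , r∈B ∷ i)
      with narrow br r∈B (proj₁ isPath) (here refl) (r∈B ∷ i)
    ... | v′ , B′ , br′ , B′⊂B , i′ = descend (s≤s z≤n) (rec B′⊂B) br′ (p , isPath , i′)
    descend {v} {B} _ _ br path | no ¬path = record
      { v = v ; B = B ; v∈W = v∈W ; B⊆W = B⊆W ; v∉B = v∉B ; path = path
      ; through = λ {p} isPath p⊆W p∩B → decidable-stable (Any.any? (v ≟_) p) λ v∉p →
          ¬path (p , isPath , linked-closed
            (λ x∈B y∈S x~y → let (y∈W , v≢y) = ∈⟪⟫⁻ S? y∈S in
               [ id , (λ y≡v → contradiction (sym y≡v) v≢y) ]′ (closed x∈B y∈W x~y))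
            (proj₁ isPath) (All.map (∈⟪⟫⁺ S?) (All.zip (p⊆W , ¬Any⇒All¬ p v∉p))) p∩B)
      }
      where
      open Branch br
      S? : Decidable λ x → x ∈ W × v ≢ x
      S? x = (x ∈? W) ×-dec ¬? (v ≟ x)

    pendant : 1 ≤ k → PathWithin k (_∈ W) → Pendant
    pendant k≥1 (p@(v ∷ _) , isPath , i@(v∈W ∷ _)) =
      descend k≥1 (⊂-wellFounded _) branch
        (p , isPath , All.map (λ x∈W → [ inj₂ , inj₁ ]′ (without-split x∈W)) i)
      where
      B? : Decidable λ x → x ∈ W × x ≢ v
      B? = without? W v
      branch : Branch W v ⟪ B? ⟫
      branch = record
        { v∈W = v∈W
        ; B⊆W = λ x∈B → proj₁ (∈⟪⟫⁻ B? x∈B)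
        ; v∉B = λ v∈B → proj₂ (∈⟪⟫⁻ B? v∈B) refl
        ; closed = λ _ y∈W _ → without-split y∈W
        }

module _ {A : Set} {P Q R : A → Set} (f : ∀ {x} → P x → Q x ⊎ R x) where

  Any-split : ∀ {m} {xs : Vec A m} → Any P xs → Any Q xs ⊎ Any R xs
  Any-split (Any.here p) with f p
  ... | inj₁ q = inj₁ (Any.here q)
  ... | inj₂ r = inj₂ (Any.here r)
  Any-split (Any.there a) with Any-split a
  ... | inj₁ q = inj₁ (Any.there q)
  ... | inj₂ r = inj₂ (Any.there r)

  All-split : ∀ {m} {xs : Vec A m} → All P xs → All Q xs ⊎ Any R xs
  All-split [] = inj₁ []
  All-split (p ∷ ps) with f p | All-split ps
  ... | inj₂ r | _       = inj₂ (Any.here r)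
  ... | inj₁ q | inj₁ qs = inj₁ (q ∷ qs)
  ... | inj₁ q | inj₂ rs = inj₂ (Any.there rs)

-- Reconfiguration sequences and canonical covers

infix 4 _↔[_]_

_↔[_]_ : ∀ {n} → Subset n → Fin n → Subset n → Set
A ↔[ x ] B = (x ∈ A → x ∈ B) × (x ∈ B → x ∈ A)

-- The disjoint union of `B` and `x` as an inductive family, so that sizes and symmetric differences
-- follow by recursion.
data Drop : ∀ {n} → Fin n → Subset n → Subset n → Set where
  here  : ∀ {n} {A : Subset n} → Drop zero (inside ∷ A) (outside ∷ A)
  there : ∀ {n x s} {A B : Subset n} → Drop x A B → Drop (suc x) (s ∷ A) (s ∷ B)

remove : ∀ {n x} {A : Subset n} → x ∈ A → ∃[ B ] Drop x A B
remove here = _ , here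
remove (there x∈A) = _ , there (proj₂ (remove x∈A))

insert : ∀ {n} x {B : Subset n} → x ∉ B → ∃[ A ] Drop x A B
insert zero    {inside  ∷ B} x∉B = contradiction here x∉B
insert zero    {outside ∷ B} x∉B = _ , here
insert (suc x) {s ∷ B}       x∉B = _ , there (proj₂ (insert x (x∉B ∘ there)))

△-self : ∀ {n} (A : Subset n) → ∣ A △ A ∣ ≡ 0
△-self []            = refl
△-self (inside  ∷ A) = △-self A
△-self (outside ∷ A) = △-self A

△-zero : ∀ {n} (A B : Subset n) → ∣ A △ B ∣ ≡ 0 → A ≡ B
△-zero []            []            _ = refl
△-zero (inside  ∷ A) (inside  ∷ B) e = cong (inside ∷_) (△-zero A B e)
△-zero (outside ∷ A) (outside ∷ B) e = cong (outside ∷_) (△-zero A B e)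

△-one : ∀ {n} (A B : Subset n) → ∣ A △ B ∣ ≡ 1 → ∃[ x ] (Drop x A B ⊎ Drop x B A)
△-one [] [] ()
△-one (inside  ∷ A) (outside ∷ B) e with refl ← △-zero A B (ℕ.suc-injective e) = zero , inj₁ here
△-one (outside ∷ A) (inside  ∷ B) e with refl ← △-zero A B (ℕ.suc-injective e) = zero , inj₂ here
△-one (inside  ∷ A) (inside  ∷ B) e with △-one A B e
... | x , inj₁ d = suc x , inj₁ (there d)
... | x , inj₂ d = suc x , inj₂ (there d)
△-one (outside ∷ A) (outside ∷ B) e with △-one A B e
... | x , inj₁ d = suc x , inj₁ (there d)
... | x , inj₂ d = suc x , inj₂ (there d)

△-comm : ∀ {n} (A B : Subset n) → A △ B ≡ B △ A
△-comm A B = ∪-comm (A ─ B) (B ─ A)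

drop-△ : ∀ {n x} {A B : Subset n} → Drop x A B → ∣ A △ B ∣ ≡ 1
drop-△ (here {A = A})               = cong suc (△-self A)
drop-△ (there {s = inside}  d) = drop-△ d
drop-△ (there {s = outside} d) = drop-△ d

drop-size : ∀ {n x} {A B : Subset n} → Drop x A B → ∣ A ∣ ≡ suc ∣ B ∣
drop-size here                    = refl
drop-size (there {s = inside}  d) = cong suc (drop-size d)
drop-size (there {s = outside} d) = drop-size d

drop-∈ : ∀ {n x} {A B : Subset n} → Drop x A B → x ∈ A
drop-∈ here      = here
drop-∈ (there d) = there (drop-∈ d)

drop-∉ : ∀ {n x} {A B : Subset n} → Drop x A B → x ∉ B
drop-∉ (there d) (there i) = drop-∉ d i

drop-⊆ : ∀ {n x} {A B : Subset n} → Drop x A B → B ⊆ A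
drop-⊆ here      (there i) = there i
drop-⊆ (there d) here      = here
drop-⊆ (there d) (there i) = there (drop-⊆ d i)

drop-split : ∀ {n x y} {A B : Subset n} → Drop x A B → y ∈ A → y ∈ B ⊎ y ≡ x
drop-split here      here      = inj₂ refl
drop-split here      (there i) = inj₁ (there i)
drop-split (there d) here      = inj₁ here
drop-split (there d) (there i) with drop-split d i
... | inj₁ j    = inj₁ (there j)
... | inj₂ refl = inj₂ refl

-- Validity is demanded of both ends, which makes the relation symmetric and sequences reversible.
Step : ∀ {n} → (Subset n → Set) → Subset n → Subset n → Set
Step P A B = P A × P B × ∣ A △ B ∣ ≡ 1

step-map : ∀ {n} {P Q : Subset n → Set} → (∀ {A} → P A → Q A) →
           ∀ {A B} → Star (Step P) A B → Star (Step Q) A B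
step-map f = Star.map λ (a , b , e) → f a , f b , e

step-sym : ∀ {n} {P : Subset n → Set} {A B} → Star (Step P) A B → Star (Step P) B A
step-sym = Star.reverse λ {A} {B} (a , b , e) → b , a , trans (cong ∣_∣ (△-comm B A)) e

shrink : ∀ {n} {P : Subset n → Set} {A C : Subset n} → C ⊆ A →
         (∀ {B} → C ⊆ B → B ⊆ A → P B) → Star (Step P) A C
shrink {P = P} {A} {C} C⊆A valid = go C⊆A id (⊂-wellFounded A)
  where
  go : ∀ {B} → C ⊆ B → B ⊆ A → Acc _⊂_ B → Star (Step P) B C
  go {B} C⊆B B⊆A (acc rec) with (any? λ x → (x ∈? B) ×-dec ¬? (x ∈? C))
  ... | no none with refl ← ⊆-antisym C⊆B
        (λ {x} x∈B → decidable-stable (x ∈? C) λ x∉C → none (x , x∈B , x∉C)) = ε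
  ... | yes (x , x∈B , x∉C) with remove x∈B
  ...   | B′ , d =
    (valid C⊆B B⊆A , valid C⊆B′ B′⊆A , drop-△ d) ◅
    go C⊆B′ B′⊆A (rec (drop-⊆ d , x , x∈B , drop-∉ d))
    where
    C⊆B′ : C ⊆ B′
    C⊆B′ y∈C = [ id , (λ { refl → contradiction y∈C x∉C }) ]′ (drop-split d (C⊆B y∈C))
    B′⊆A : B′ ⊆ A
    B′⊆A y∈B′ = B⊆A (drop-⊆ d y∈B′)

-- Canonical covers by peeling off pendant branches

module _ {n} (G : Graph n) (k : ℕ) where
  open Graph G using (IsPath; Acyclic)

  Covers : Subset n → Subset n → Set
  Covers W I = ∀ {p : Vec (Fin n) k} → IsPath p → All (_∈ W) p → Any (_∈ I) p

  -- `fixed` freezes the set outside `W`, so that vertices already peeled off keep their state while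
  -- the rest of the tree is rearranged.
  record Valid (W I : Subset n) (u : ℕ) (A : Subset n) : Set where
    field
      covers : Covers W A
      small  : ∣ A ∣ ≤ u
      fixed  : ∀ {x} → x ∉ W → A ↔[ x ] I

  -- As K does not depend on I, any two covers of W can be brought to agree on W.
  record Canonical (W : Subset n) : Set where
    field
      K     : Subset n
      reach : ∀ {I s} → Covers W I → ∣ I ∣ ≤ s →
              ∃[ A ] (Star (Step (Valid W I (suc s))) I A × (∀ {x} → x ∈ W → A ↔[ x ] K))

  module _ (k≥1 : 1 ≤ k) (acyclic : Acyclic) where

    -- With no k-path inside `W` to hit, all of `I` inside `W` can be deleted one vertex at a time.
    no-path : ∀ {W} → ¬ PathWithin G k (_∈ W) → Canonical W
    no-path {W} ¬path = record
      { K = ⊥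
      ; reach = λ {I} {s} cov small → let open Outside I in _
          , shrink (λ x∈ → proj₁ (∈⟪⟫⁻ O? x∈)) (λ {B} C⊆B B⊆I → record
              { covers = λ {p} isPath p⊆W → contradiction (p , isPath , p⊆W) ¬path
              ; small = ℕ.m≤n⇒m≤1+n (ℕ.≤-trans (p⊆q⇒∣p∣≤∣q∣ B⊆I) small)
              ; fixed = λ x∉W → B⊆I , λ x∈I → C⊆B (∈⟪⟫⁺ O? (x∈I , x∉W))
              })
          , λ x∈W → (λ x∈O → contradiction x∈W (proj₂ (∈⟪⟫⁻ O? x∈O)))
                  , (λ x∈⊥ → contradiction x∈⊥ ∉⊥)
      }
      where
      module Outside (I : Subset n) where
        O? : Decidable λ x → x ∈ I × x ∉ W
        O? x = (x ∈? I) ×-dec ¬? (x ∈? W)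

    module Peel {W} (pd : Pendant G acyclic {k} W) where
      open Pendant pd

      W′? : Decidable λ x → x ∈ W × ¬ (x ≡ v ⊎ x ∈ B)
      W′? x = (x ∈? W) ×-dec ¬? ((x ≟ v) ⊎-dec (x ∈? B))

      W′ : Subset n
      W′ = ⟪ W′? ⟫

      W′⊂W : W′ ⊂ W
      W′⊂W = (λ x∈W′ → proj₁ (∈⟪⟫⁻ W′? x∈W′)) , v , v∈W , λ v∈W′ → proj₂ (∈⟪⟫⁻ W′? v∈W′) (inj₁ refl)

      v∉W′ : v ∉ W′
      v∉W′ v∈W′ = proj₂ (∈⟪⟫⁻ W′? v∈W′) (inj₁ refl)

      parts : ∀ {x} → x ∈ W → x ∈ W′ ⊎ (x ≡ v ⊎ x ∈ B)
      parts {x} x∈W with (x ≟ v) ⊎-dec (x ∈? B)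
      ... | yes i = inj₂ i
      ... | no ¬i = inj₁ (∈⟪⟫⁺ W′? (x∈W , ¬i))

      module Trim (I : Subset n) (cov : Covers W I) where

        C? : Decidable λ x → x ≡ v ⊎ (x ∈ I × x ∉ B)
        C? x = (x ≟ v) ⊎-dec ((x ∈? I) ×-dec ¬? (x ∈? B))

        C : Subset n
        C = ⟪ C? ⟫

        v∈C : v ∈ C
        v∈C = ∈⟪⟫⁺ C? (inj₁ refl)

        hit : ∀ {x} → x ∈ I → x ∈ B ⊎ x ∈ C
        hit {x} x∈I with x ∈? B
        ... | yes x∈B = inj₁ x∈B
        ... | no  x∉B = inj₂ (∈⟪⟫⁺ C? (inj₂ (x∈I , x∉B)))

        -- A hit outside `B` survives in `C`; a hit inside `B` forces the path through `v`.
        C-covers : Covers W C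
        C-covers isPath p⊆W with Any-split hit (cov isPath p⊆W)
        ... | inj₁ p∩B = Any.map (λ { refl → v∈C }) (through isPath p⊆W p∩B)
        ... | inj₂ p∩C = p∩C

        C-fixed : ∀ {x} → x ∉ W → C ↔[ x ] I
        C-fixed x∉W =
          (λ x∈C → [ (λ { refl → contradiction v∈W x∉W }) , proj₁ ]′ (∈⟪⟫⁻ C? x∈C)) ,
          (λ x∈I → ∈⟪⟫⁺ C? (inj₂ (x∈I , λ x∈B → x∉W (B⊆W x∈B))))

        record Extended (s : ℕ) (I⁺ : Subset n) : Set where
          field
            v∈I⁺  : v ∈ I⁺
            I⊆I⁺  : I ⊆ I⁺
            I⁺⊆   : ∀ {x} → x ∈ I⁺ → x ∈ I ⊎ x ≡ v
            small : ∣ I⁺ ∣ ≤ suc s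

        trim : ∀ {s I⁺} → Extended s I⁺ → Star (Step (Valid W I (suc s))) I⁺ C
        trim ext = shrink
            (λ x∈C → [ (λ { refl → v∈I⁺ }) , (λ (x∈I , _) → I⊆I⁺ x∈I) ]′ (∈⟪⟫⁻ C? x∈C))
            (λ C⊆A A⊆I⁺ → record
              { covers = λ isPath p⊆W → Any.map C⊆A (C-covers isPath p⊆W)
              ; small = ℕ.≤-trans (p⊆q⇒∣p∣≤∣q∣ A⊆I⁺) small
              ; fixed = λ x∉W →
                  (λ x∈A → [ id , (λ { refl → contradiction v∈W x∉W }) ]′ (I⁺⊆ (A⊆I⁺ x∈A))) ,
                  (λ x∈I → C⊆A (proj₂ (C-fixed x∉W) x∈I))
              })
          where open Extended ext

        I∩branch : Any (λ x → x ∈ I) (proj₁ path)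
        I∩branch = cov (proj₁ (proj₂ path))
          (All.map [ (λ { refl → v∈W }) , B⊆W ]′ (proj₂ (proj₂ path)))

        -- If `v` is in `I`, then `C` is contained in `I`. Otherwise adding `v` takes one extra
        -- vertex, which is paid back: `I` hits the k-path inside `B` and `v` at a vertex of `B`,
        -- and that vertex is deleted.
        exchange : ∀ {s} → ∣ I ∣ ≤ s → Star (Step (Valid W I (suc s))) I C × ∣ C ∣ ≤ s
        exchange {s} small with v ∈? I
        ... | yes v∈I =
          trim record { v∈I⁺ = v∈I ; I⊆I⁺ = id ; I⁺⊆ = inj₁ ; small = ℕ.m≤n⇒m≤1+n small } ,
          ℕ.≤-trans (p⊆q⇒∣p∣≤∣q∣ λ x∈C → [ (λ { refl → v∈I }) , proj₁ ]′ (∈⟪⟫⁻ C? x∈C)) small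
        ... | no v∉I with insert v v∉I
        ...   | I⁺ , d =
          (here-valid , I⁺-valid , trans (cong ∣_∣ (△-comm I I⁺)) (drop-△ d)) ◅ trim ext ,
          ℕ.≤-pred (ℕ.≤-trans (p⊂q⇒∣p∣<∣q∣ C⊂I⁺) (Extended.small ext))
          where
          ext : Extended s I⁺
          ext = record { v∈I⁺ = drop-∈ d ; I⊆I⁺ = drop-⊆ d ; I⁺⊆ = drop-split d
                       ; small = subst (_≤ suc s) (sym (drop-size d)) (s≤s small) }
          here-valid : Valid W I (suc s) I
          here-valid = record { covers = cov ; small = ℕ.m≤n⇒m≤1+n small ; fixed = λ _ → id , id }
          I⁺-valid : Valid W I (suc s) I⁺
          I⁺-valid = record
            { covers = λ isPath p⊆W → Any.map (drop-⊆ d) (cov isPath p⊆W)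
            ; small = Extended.small ext
            ; fixed = λ x∉W →
                (λ x∈I⁺ → [ id , (λ { refl → contradiction v∈W x∉W }) ]′ (drop-split d x∈I⁺)) ,
                drop-⊆ d }
          C⊂I⁺ : C ⊂ I⁺
          C⊂I⁺ with All.lookupAny (proj₂ (proj₂ path)) I∩branch
          ... | inj₁ w≡v , w∈I = contradiction (subst (_∈ I) w≡v w∈I) v∉I
          ... | inj₂ w∈B , w∈I =
            (λ x∈C → [ (λ { refl → drop-∈ d }) , (λ (x∈I , _) → drop-⊆ d x∈I) ]′ (∈⟪⟫⁻ C? x∈C)) ,
            _ , drop-⊆ d w∈I ,
            λ w∈C → [ (λ w≡v → v∉B (subst (_∈ B) w≡v w∈B)) , (λ (_ , w∉B) → w∉B w∈B) ]′ (∈⟪⟫⁻ C? w∈C)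

        C-covers′ : Covers W′ C
        C-covers′ isPath p⊆W′ = C-covers isPath (All.map (proj₁ W′⊂W) p⊆W′)

        -- As `v` lies outside `W′`, it is frozen in `A`. A k-path in `W` that leaves `W′` contains
        -- `v`, either directly or because it meets `B`.
        lift : ∀ {s A} → Valid W′ C s A → Valid W I s A
        lift {s} {A} val = record
          { covers = cov′
          ; small = Valid.small val
          ; fixed = λ x∉W →
              let (f , g) = Valid.fixed val (λ x∈W′ → x∉W (proj₁ W′⊂W x∈W′))
                  (f′ , g′) = C-fixed x∉W in (λ x∈A → f′ (f x∈A)) , λ x∈I → g (g′ x∈I)
          }
          where
          v∈A : v ∈ A
          v∈A = proj₂ (Valid.fixed val v∉W′) v∈C
          via-v : ∀ {p : Vec (Fin n) k} → Any (v ≡_) p → Any (_∈ A) p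
          via-v = Any.map λ { refl → v∈A }
          cov′ : Covers W A
          cov′ isPath p⊆W with All-split parts p⊆W
          ... | inj₁ p⊆W′ = Valid.covers val isPath p⊆W′
          ... | inj₂ rest with Any-split id rest
          ...   | inj₁ v∈p = via-v (Any.map sym v∈p)
          ...   | inj₂ p∩B = via-v (through isPath p⊆W p∩B)

      -- The new canonical cover is that of `W′` together with `v`: on `B` and `v` the outcome of
      -- the exchange does not depend on `I`, and it is frozen from then on.
      extend : Canonical W′ → Canonical W
      extend can = record
        { K = ⟪ K? ⟫
        ; reach = λ {I} cov small →
            let open Trim I cov
                (I⇝C , C-small) = exchange small
                (A , C⇝A , A↔K) = reach C-covers′ C-small
                valid = λ {x} → A-fixed {C = C} (λ {x} x∈C → ∈⟪⟫⁻ C? x∈C) v∈C C⇝A A↔K {x}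
            in A , I⇝C ◅◅ step-map lift C⇝A , valid
        }
        where
        open Canonical can
        K? : Decidable λ x → x ≡ v ⊎ (x ∈ W′ × x ∈ K)
        K? x = (x ≟ v) ⊎-dec ((x ∈? W′) ×-dec (x ∈? K))
        end-fixed : ∀ {C s A} → Star (Step (Valid W′ C s)) C A → ∀ {x} → x ∉ W′ → A ↔[ x ] C
        end-fixed C⇝A x∉W′ = go C⇝A (id , id)
          where
          go : ∀ {C s A B} → Star (Step (Valid W′ C s)) B A → B ↔[ _ ] C → A ↔[ _ ] C
          -- The empty sequence carries no validity proof, so agreement at the current set is handed
          -- along.
          go ε e = e
          go ((_ , b , _) ◅ r) _ = go r (Valid.fixed b x∉W′)
        A-fixed : ∀ {I C s A} → (∀ {x} → x ∈ C → x ≡ v ⊎ (x ∈ I × x ∉ B)) → v ∈ C →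
                  Star (Step (Valid W′ C s)) C A → (∀ {x} → x ∈ W′ → A ↔[ x ] K) →
                  ∀ {x} → x ∈ W → A ↔[ x ] ⟪ K? ⟫
        A-fixed C⁻ v∈C C⇝A A↔K x∈W with parts x∈W
        ... | inj₁ x∈W′ =
          (λ x∈A → ∈⟪⟫⁺ K? (inj₂ (x∈W′ , proj₁ (A↔K x∈W′) x∈A))) ,
          (λ x∈K → [ (λ { refl → contradiction x∈W′ v∉W′ }) , (λ (_ , x∈K′) → proj₂ (A↔K x∈W′) x∈K′) ]′
                     (∈⟪⟫⁻ K? x∈K))
        ... | inj₂ (inj₁ refl) =
          (λ _ → ∈⟪⟫⁺ K? (inj₁ refl)) , (λ _ → proj₂ (end-fixed C⇝A v∉W′) v∈C)
        ... | inj₂ (inj₂ x∈B) =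
          (λ x∈A → [ (λ { refl → contradiction x∈B v∉B }) , (λ (_ , x∉B) → contradiction x∈B x∉B) ]′
                     (C⁻ (proj₁ (end-fixed C⇝A x∉W′) x∈A))) ,
          (λ x∈K → [ (λ { refl → contradiction x∈B v∉B }) , (λ (x∈W′ , _) → contradiction x∈W′ x∉W′) ]′
                     (∈⟪⟫⁻ K? x∈K))
          where
          x∉W′ : _ ∉ W′
          x∉W′ x∈W′ = proj₂ (∈⟪⟫⁻ W′? x∈W′) (inj₂ x∈B)

    canonical : ∀ W → Acc _⊂_ W → Canonical W
    canonical W (acc rec) with pathWithin? G k (_∈? W)
    ... | no ¬path = no-path ¬path
    ... | yes path = extend (canonical W′ (rec W′⊂W))
      where open Peel (pendant G acyclic W k≥1 path)

-- The criterion for reconfigurability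

module _ {n} (G : Graph n) (k u : ℕ) where
  open Graph G using (IsPath; Acyclic)

  TARState : Subset n → Set
  TARState A = IsPathVertexCover k G A × ∣ A ∣ ≤ u

  -- The negation of being stuck. That `I` without `v` still covers is phrased through hits other
  -- than `v`, which makes it first-order in `I`.
  Mobile : Subset n → Set
  Mobile I = ∣ I ∣ < u ⊎
    ∃[ v ] (v ∈ I × ((p : Vec (Fin n) k) → IsPath p → Any (λ x → x ∈ I × x ≢ v) p))

  -- A step that removes `v` shows that the remaining vertices still cover; a step that adds `v`
  -- shows that there was room for one more.
  step-mobile : ∀ {A B} → Step TARState A B → Mobile A
  step-mobile {A} {B} ((_ , _) , (B-cov , B≤u) , e) with △-one A B e
  ... | v , inj₁ d = inj₂ (v , drop-∈ d , λ p isPath → Any.map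
          (λ x∈B → drop-⊆ d x∈B , λ { refl → drop-∉ d x∈B }) (B-cov p isPath))
  ... | v , inj₂ d = inj₁ (subst (_≤ u) (drop-size d) B≤u)

  mobile-shrinks : ∀ {I} → TARState I → Mobile I →
                   ∃[ I′ ] (Star (Step TARState) I I′ × IsPathVertexCover k G I′ × ∣ I′ ∣ < u)
  mobile-shrinks {I} (cov , _) (inj₁ small) = I , ε , cov , small
  mobile-shrinks {I} (cov , I≤u) (inj₂ (v , v∈I , cov′)) with remove v∈I
  ... | I′ , d = I′ , (((cov , I≤u) , (covers , ℕ.<⇒≤ small) , drop-△ d) ◅ ε) , covers , small
    where
    small : ∣ I′ ∣ < u
    small = subst (_≤ u) (drop-size d) I≤u
    covers : IsPathVertexCover k G I′
    covers p isPath = Any.map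
      (λ (x∈I , x≢v) → [ id , (λ x≡v → contradiction x≡v x≢v) ]′ (drop-split d x∈I)) (cov′ p isPath)

  -- Writing `u` as `suc s`, both covers have at most `s` vertices, so the one extra vertex needed
  -- on the way to `K` fits into `u`. On the full vertex set, agreeing with `K` means being equal to
  -- it.
  small-reconfigurable : 1 ≤ k → Acyclic → ∀ {I J} →
    IsPathVertexCover k G I → IsPathVertexCover k G J → ∣ I ∣ < u → ∣ J ∣ < u →
    Star (Step TARState) I J
  small-reconfigurable k≥1 acyclic {I} {J} I-cov J-cov (s≤s {n = s} I≤s) (s≤s J≤s) =
    to-K I-cov I≤s ◅◅ step-sym (to-K J-cov J≤s)
    where
    open Canonical (canonical G k k≥1 acyclic ⊤ (⊂-wellFounded ⊤))
    to-K : ∀ {I} → IsPathVertexCover k G I → ∣ I ∣ ≤ s → Star (Step TARState) I K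
    to-K cov I≤s with reach (λ {p} isPath _ → cov p isPath) I≤s
    ... | A , I⇝A , A↔K = subst (Star (Step TARState) _)
      (⊆-antisym (proj₁ (A↔K ∈⊤)) (proj₂ (A↔K ∈⊤)))
      (step-map (λ val → (λ p isPath → Valid.covers val isPath (All.universal (λ _ → ∈⊤) p))
                       , Valid.small val) I⇝A)

  toSequence : ∀ {I J} → TARState I → Star (Step TARState) I J → TAR-Reconfigurable k G u I J
  toSequence {I} (cov , small) ε = 0 , I ∷ [] , record
    { covers = cov ∷ [] ; sizes = small ∷ [] ; steps = [-] ; start = refl ; end = refl }
  toSequence {I} (cov , small) ((_ , b , e) ◅ r) with toSequence b r
  ... | ℓ , Is , tar = suc ℓ , I ∷ Is , record
    { covers = cov ∷ covers ; sizes = small ∷ sizes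
    ; steps = subst (λ A → ∣ I △ A ∣ ≡ 1) (sym start) e ∷ steps ; start = refl ; end = end }
    where open IsTARSequence tar

  fromSequence : ∀ {ℓ} (Is : Vec (Subset n) (suc ℓ)) → All (IsPathVertexCover k G) Is →
                 All (λ A → ∣ A ∣ ≤ u) Is → Linked (λ A B → ∣ A △ B ∣ ≡ 1) Is →
                 Star (Step TARState) (head Is) (last Is)
  fromSequence (A ∷ [])     _ _ _ = ε
  fromSequence (A ∷ B ∷ Is) (a ∷ cs@(b ∷ _)) (a′ ∷ ss@(b′ ∷ _)) (e ∷ l) =
    ((a , a′) , (b , b′) , e) ◅ fromSequence (B ∷ Is) cs ss l

  Criterion : Subset n → Subset n → Set
  Criterion I J = ∣ I ∣ ≤ u × ∣ J ∣ ≤ u × (I ≡ J ⊎ (Mobile I × Mobile J))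

  criterion-sound : 1 ≤ k → Acyclic → ∀ {I J} →
    IsPathVertexCover k G I → IsPathVertexCover k G J →
    Criterion I J → TAR-Reconfigurable k G u I J
  criterion-sound _ _ I-cov J-cov (I≤u , J≤u , inj₁ refl) = toSequence (I-cov , I≤u) ε
  criterion-sound k≥1 acyclic I-cov J-cov (I≤u , J≤u , inj₂ (mI , mJ))
    with mobile-shrinks (I-cov , I≤u) mI | mobile-shrinks (J-cov , J≤u) mJ
  ... | I′ , I⇝I′ , I′-cov , I′<u | J′ , J⇝J′ , J′-cov , J′<u =
    toSequence (I-cov , I≤u)
      (I⇝I′ ◅◅ small-reconfigurable k≥1 acyclic I′-cov J′-cov I′<u J′<u ◅◅ step-sym J⇝J′)

  -- A nonempty sequence has a first step at `I`, and its reversal has a first step at `J`; each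
  -- step makes its starting set mobile.
  criterion-complete : ∀ {I J} → TAR-Reconfigurable k G u I J → Criterion I J
  criterion-complete (_ , Is@(_ ∷ _) , record
    { covers = cs ; sizes = ss ; steps = l ; start = refl ; end = refl }) =
    All.head ss , last-small Is ss , ends (fromSequence Is cs ss l)
    where
    last-small : ∀ {ℓ} (Is : Vec (Subset n) (suc ℓ)) → All (λ A → ∣ A ∣ ≤ u) Is → ∣ last Is ∣ ≤ u
    last-small (_ ∷ [])     (s ∷ [])       = s
    last-small (_ ∷ B ∷ Is) (_ ∷ ss)       = last-small (B ∷ Is) ss
    ends : ∀ {I J} → Star (Step TARState) I J → I ≡ J ⊎ (Mobile I × Mobile J)
    ends ε       = inj₁ refl
    ends I⇝J@(s ◅ _) with step-sym I⇝J
    ... | ε      = inj₁ refl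
    ... | s′ ◅ _ = inj₂ (step-mobile s , step-mobile s′)

-- Polynomial-time evaluation of first-order formulas

data Polynomial : Set where
  con     : ℕ → Polynomial
  X       : Polynomial
  _⊕_ _⊗_ : Polynomial → Polynomial → Polynomial

infixr 6 _⊕_
infixr 7 _⊗_

⟦_⟧ : Polynomial → ℕ → ℕ
⟦ con c ⟧ N = c
⟦ X     ⟧ N = N
⟦ P ⊕ Q ⟧ N = ⟦ P ⟧ N + ⟦ Q ⟧ N
⟦ P ⊗ Q ⟧ N = ⟦ P ⟧ N * ⟦ Q ⟧ N

-- Degrees are added even for a sum; this is allowed because `N` is at least 1, so that powers of
-- `N` grow with the exponent.
monomial-bound : ∀ P → ∃[ c ] ∃[ d ] (∀ {N} → 1 ≤ N → ⟦ P ⟧ N ≤ c * N ^ d)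
monomial-bound (con c) = c , 0 , λ _ → ℕ.≤-reflexive (sym (ℕ.*-identityʳ c))
monomial-bound X       = 1 , 1 , λ {N} _ → ℕ.≤-reflexive
  (sym (trans (ℕ.*-identityˡ (N * 1)) (ℕ.*-identityʳ N)))
monomial-bound (P ⊕ Q) with monomial-bound P | monomial-bound Q
... | c , d , p | c′ , d′ , q = c + c′ , d + d′ , λ { {N@(suc _)} N≥1 → begin
  ⟦ P ⟧ N + ⟦ Q ⟧ N                    ≤⟨ ℕ.+-mono-≤ (p N≥1) (q N≥1) ⟩
  c * N ^ d + c′ * N ^ d′              ≤⟨ ℕ.+-mono-≤ (ℕ.*-monoʳ-≤ c (ℕ.^-monoʳ-≤ N (ℕ.m≤m+n d d′)))
                                                     (ℕ.*-monoʳ-≤ c′ (ℕ.^-monoʳ-≤ N (ℕ.m≤n+m d′ d))) ⟩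
  c * N ^ (d + d′) + c′ * N ^ (d + d′) ≡⟨ ℕ.*-distribʳ-+ (N ^ (d + d′)) c c′ ⟨
  (c + c′) * N ^ (d + d′)              ∎ }
  where open ℕ.≤-Reasoning
monomial-bound (P ⊗ Q) with monomial-bound P | monomial-bound Q
... | c , d , p | c′ , d′ , q = c * c′ , d + d′ , λ {N} N≥1 → begin
  ⟦ P ⟧ N * ⟦ Q ⟧ N           ≤⟨ ℕ.*-mono-≤ (p N≥1) (q N≥1) ⟩
  c * N ^ d * (c′ * N ^ d′)   ≡⟨ ℕ.[m*n]*[o*p]≡[m*o]*[n*p] c (N ^ d) c′ (N ^ d′) ⟩
  c * c′ * (N ^ d * N ^ d′)   ≡⟨ cong (c * c′ *_) (ℕ.^-distribˡ-+-* N d d′) ⟨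
  c * c′ * N ^ (d + d′)       ∎
  where open ℕ.≤-Reasoning

-- Execution of commands within a time bound

Run : ∀ {m} → Cmd m → Store m → Store m → ℕ → Set
Run C s s′ T = ∃[ t ] (⟨ C , s ⟩⇓ s′ in-time t × t ≤ T)

module _ {m : ℕ} where

  weaken : ∀ {C : Cmd m} {s s′ T T′} → T ≤ T′ → Run C s s′ T → Run C s s′ T′
  weaken T≤T′ (t , r , t≤T) = t , r , ℕ.≤-trans t≤T T≤T′

  run-≔ : ∀ {x} {e : Expr m} {s} → Run (x ≔ e) s (s [ x ]≔ eval e s) (suc (cost e))
  run-≔ = _ , assign , ℕ.≤-refl

  infixr 4 _run-⨾_

  _run-⨾_ : ∀ {C D : Cmd m} {s s′ s″ T T′} →
            Run C s s′ T → Run D s′ s″ T′ → Run (C ⨾ D) s s″ (T + T′)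
  (_ , c , p) run-⨾ (_ , d , q) = _ , seq c d , ℕ.+-mono-≤ p q

  run-true : ∀ {e} {C D : Cmd m} {s s′ x y T} → eval e s ≡ x ∙ y →
             Run C s s′ T → Run (if e then C else D) s s′ (suc (cost e) + T)
  run-true {e} eq (_ , c , p) = _ , if-true eq c , ℕ.+-monoʳ-≤ (suc (cost e)) p

  run-false : ∀ {e} {C D : Cmd m} {s s′ T} → eval e s ≡ nil →
              Run D s s′ T → Run (if e then C else D) s s′ (suc (cost e) + T)
  run-false {e} eq (_ , d , p) = _ , if-false eq d , ℕ.+-monoʳ-≤ (suc (cost e)) p

  run-stop : ∀ {e} {C : Cmd m} {s} → eval e s ≡ nil → Run (while e loop C) s s (suc (cost e))
  run-stop eq = _ , while-false eq , ℕ.≤-refl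

  -- `U` bounds one round including its test, `i` the number of rounds still to come, and `w` pays
  -- for the final test.
  run-loop : ∀ {e} {C : Cmd m} {s s′ s″ x y T} U i w → eval e s ≡ x ∙ y →
             Run C s s′ T → suc (cost e) + T ≤ U → Run (while e loop C) s′ s″ (i * U + w) →
             Run (while e loop C) s s″ (suc i * U + w)
  run-loop {e} {T = T} U i w eq (t , c , p) T≤U (t′ , d , q) = _ , while-true eq c d , (begin
    suc (cost e) + (t + t′)       ≡⟨ ℕ.+-assoc (suc (cost e)) t t′ ⟨
    suc (cost e) + t + t′         ≤⟨ ℕ.+-mono-≤ (ℕ.≤-trans (ℕ.+-monoʳ-≤ (suc (cost e)) p) T≤U) q ⟩
    U + (i * U + w)               ≡⟨ ℕ.+-assoc U (i * U) w ⟨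
    U + i * U + w                 ∎)
    where open ℕ.≤-Reasoning

-- Trees as lists, and as unary numbers read off the right spine

spine : 𝔻 → ℕ
spine nil     = 0
spine (_ ∙ d) = suc (spine d)

cdrs : ℕ → 𝔻 → 𝔻
cdrs zero    d = d
cdrs (suc i) d = cdrs i (cdr d)

spine<size : ∀ d → spine d < size d
spine<size nil     = s≤s z≤n
spine<size (a ∙ d) = s≤s (ℕ.≤-trans (spine<size d) (ℕ.m≤n+m (size d) (size a)))

spine-cdr : ∀ d → spine (cdr d) ≡ pred (spine d)
spine-cdr nil     = refl
spine-cdr (_ ∙ _) = refl

spine-cdrs : ∀ i d → spine (cdrs i d) ≡ spine d ∸ i
spine-cdrs zero    d       = refl
spine-cdrs (suc i) nil     = trans (spine-cdrs i nil) (ℕ.0∸n≡0 i)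
spine-cdrs (suc i) (_ ∙ d) = spine-cdrs i d

IsNil : 𝔻 → Set
IsNil d = d ≡ nil

spine-0 : ∀ {d} → spine d ≡ 0 → IsNil d
spine-0 {nil} _ = refl

spine-encodeVec : ∀ {A : Set} {n} (f : A → 𝔻) (xs : Vec A n) → spine (encodeVec f xs) ≡ n
spine-encodeVec f []       = refl
spine-encodeVec f (x ∷ xs) = cong suc (spine-encodeVec f xs)

car-cdrs : ∀ {A : Set} {n} (f : A → 𝔻) (xs : Vec A n) v →
           car (cdrs (toℕ v) (encodeVec f xs)) ≡ f (lookup xs v)
car-cdrs f (x ∷ xs) zero    = refl
car-cdrs f (x ∷ xs) (suc v) = car-cdrs f xs v

∈-reflects : ∀ {n} (v : Fin n) (S : Subset n) → Reflects (v ∈ S) (lookup S v)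
∈-reflects v S with lookup S v in eq
... | true  = ofʸ (lookup⇒[]= v S eq)
... | false = ofⁿ λ v∈S → contradiction (trans (sym ([]=⇒lookup v∈S)) eq) λ ()

-- The instance, the environment, and three work registers, of which `ra` also
-- receives the truth value of a formula.
pattern rg = zero
pattern re = suc zero
pattern ra = suc (suc zero)
pattern rb = suc (suc (suc zero))
pattern rc = suc (suc (suc (suc zero)))

-- Formulas and their translation into commands

yesᵉ : Expr 5
yesᵉ = cons nil nil

-- Vertices are named by de Bruijn indices; `false` stands for I, `true` for J.
data Formula (m : ℕ) : Set where
  adj le   : Fin m → Fin m → Formula m
  mem      : Bool → Fin m → Formula m
  card<    : Bool → Formula m
  card≤    : Bool → Formula m
  top      : Formula m
  neg      : Formula m → Formula m
  and or   : Formula m → Formula m → Formula m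
  ex       : Formula (suc m) → Formula m

-- The vertex v is represented by any tree whose spine has length v + 1.
nth : ∀ {m} → Fin m → Expr 5 → Expr 5
nth zero    e = hd e
nth (suc x) e = nth x (tl e)

setᵉ : Bool → Expr 5
setᵉ false = hd (tl (var rg))
setᵉ true  = hd (tl (tl (var rg)))

-- Serves two purposes: afterwards the head of `rb` is the entry at position `ra`, and the length of
-- `rb` is the truncated difference of the two lengths.
dropᶜ : Cmd 5
dropᶜ = while var ra loop (rb ≔ tl (var rb) ⨾ ra ≔ tl (var ra))

countᶜ : Cmd 5
countᶜ = while var rb loop
  ((if hd (var rb) then ra ≔ cons nil (var ra) else (ra ≔ var ra)) ⨾
   rb ≔ tl (var rb))

halveᶜ : Cmd 5
halveᶜ = while var ra loop (rc ≔ cons nil (var rc) ⨾ ra ≔ tl (tl (var ra)))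

-- Compares the length of `ra` with the digits of u, least significant first:
-- m ≤ d + 2 x if and only if ⌈(m ∸ d) / 2⌉ ≤ x.
compareᶜ : Cmd 5
compareᶜ = while var rb loop
  ((if hd (var rb) then ra ≔ tl (tl (var ra)) else (ra ≔ tl (var ra))) ⨾
   rc ≔ nil ⨾ halveᶜ ⨾ ra ≔ var rc ⨾ rb ≔ tl (var rb))

notᶜ : Expr 5 → Cmd 5
notᶜ e = if e then ra ≔ nil else (ra ≔ yesᵉ)

-- The counter starts from e, which has length 1 for the strict comparison.
cardᶜ : Bool → Expr 5 → Cmd 5
cardᶜ S e =
  ra ≔ e ⨾ rb ≔ setᵉ S ⨾ countᶜ ⨾
  rb ≔ tl (tl (tl (var rg))) ⨾ compareᶜ ⨾ notᶜ (var ra)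

-- The vertices are tried from the last to the first, starting from the list of
-- the rows of the adjacency matrix as a numeral; success resets the numeral to
-- `nil` and so ends the loop.
exᶜ : Cmd 5 → Cmd 5
exᶜ C = while hd (var re) loop
  (C ⨾ (if var ra then re ≔ cons nil (tl (var re))
                  else (re ≔ cons (tl (hd (var re))) (tl (var re)))))

compile : ∀ {m} → Formula m → Cmd 5
compile (adj x y) =
  ra ≔ tl (nth x (var re)) ⨾ rb ≔ hd (var rg) ⨾ dropᶜ ⨾ rb ≔ hd (var rb) ⨾
  ra ≔ tl (nth y (var re)) ⨾ dropᶜ ⨾ ra ≔ hd (var rb)
-- Both numerals are one longer than their vertices, which cancels: nothing is left of `x` exactly
-- when `x` is at most `y`.
compile (le x y)  =
  ra ≔ nth y (var re) ⨾ rb ≔ nth x (var re) ⨾ dropᶜ ⨾ notᶜ (var rb)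
compile (mem S x) =
  ra ≔ tl (nth x (var re)) ⨾ rb ≔ setᵉ S ⨾ dropᶜ ⨾ ra ≔ hd (var rb)
compile (card< S) = cardᶜ S yesᵉ
compile (card≤ S) = cardᶜ S nil
compile top       = ra ≔ yesᵉ
compile (neg φ)   = compile φ ⨾ notᶜ (var ra)
compile (and φ ψ) = compile φ ⨾ (if var ra then compile ψ else (ra ≔ nil))
compile (or φ ψ)  = compile φ ⨾ (if var ra then ra ≔ yesᵉ else (compile ψ))
compile (ex φ)    =
  re ≔ cons (hd (var rg)) (var re) ⨾ ra ≔ nil ⨾ exᶜ (compile φ) ⨾ re ≔ tl (var re)

-- Time bounds for compiled formulas

assignᵗ : Expr 5 → Polynomial
assignᵗ e = con (suc (cost e))

-- A round of `dropᶜ` costs 2 for the test and 3 for each assignment; the failing test at the end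
-- costs 2. In `notᵗ`, 2 pays for the test and 4 for the costlier branch.
dropᵗ notᵗ : Polynomial
dropᵗ = X ⊗ con 8 ⊕ con 2
notᵗ = con 6

cardᵗ : Bool → Expr 5 → Polynomial
cardᵗ S e = assignᵗ e ⊕ assignᵗ (setᵉ S) ⊕ (X ⊗ con 12 ⊕ con 2) ⊕ con 5 ⊕
            (X ⊗ (con 2 ⊕ con 7 ⊕ con 2 ⊕ (X ⊗ con 10 ⊕ con 2) ⊕ con 2 ⊕ con 3) ⊕ con 2) ⊕ notᵗ

-- Follows the compilation clause by clause. For `and` and `or` the costs of the two branches are
-- added rather than maximised; for `ex`, 9 is the test of `ra` with the costlier update of `re`,
-- and `X` bounds the number of vertices.
time : ∀ {m} → Formula m → Polynomial
time (adj x y) = assignᵗ (tl (nth x (var re))) ⊕ con 3 ⊕ dropᵗ ⊕ con 3 ⊕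
                 assignᵗ (tl (nth y (var re))) ⊕ dropᵗ ⊕ con 3
time (le x y)  = assignᵗ (nth y (var re)) ⊕ assignᵗ (nth x (var re)) ⊕ dropᵗ ⊕ notᵗ
time (mem S x) = assignᵗ (tl (nth x (var re))) ⊕ assignᵗ (setᵉ S) ⊕ dropᵗ ⊕ con 3
time (card< S) = cardᵗ S yesᵉ
time (card≤ S) = cardᵗ S nil
time top       = assignᵗ yesᵉ
time (neg φ)   = time φ ⊕ notᵗ
time (and φ ψ) = time φ ⊕ con 2 ⊕ (time ψ ⊕ con 2)
time (or φ ψ)  = time φ ⊕ con 2 ⊕ (time ψ ⊕ con 4)
time (ex φ)    = con 5 ⊕ con 2 ⊕ (X ⊗ (con 3 ⊕ time φ ⊕ con 9) ⊕ con 3) ⊕ con 3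

⌈/2⌉-≤⁺ : ∀ m k → ⌈ m /2⌉ ≤ k → m ≤ 2 * k
⌈/2⌉-≤⁺ zero          k       _       = z≤n
⌈/2⌉-≤⁺ (suc zero)    (suc k) _       = s≤s z≤n
⌈/2⌉-≤⁺ (suc (suc m)) (suc k) (s≤s p) rewrite ℕ.*-suc 2 k = s≤s (s≤s (⌈/2⌉-≤⁺ m k p))

⌈/2⌉-≤⁻ : ∀ m k → m ≤ 2 * k → ⌈ m /2⌉ ≤ k
⌈/2⌉-≤⁻ zero          k       _ = z≤n
⌈/2⌉-≤⁻ (suc zero)    (suc k) _ = s≤s z≤n
⌈/2⌉-≤⁻ (suc (suc m)) (suc k) p rewrite ℕ.*-suc 2 k = s≤s (⌈/2⌉-≤⁻ m k (ℕ.≤-pred (ℕ.≤-pred p)))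

cdr-≤ : ∀ d {m} → spine d ≤ m → spine (cdr d) ≤ m
cdr-≤ nil     p = p
cdr-≤ (_ ∙ d) p = ℕ.<⇒≤ p

≤-cdr⁻ : ∀ d {m} → spine d ≤ suc m → spine (cdr d) ≤ m
≤-cdr⁻ nil     _       = z≤n
≤-cdr⁻ (_ ∙ _) (s≤s p) = p

≤-cdr⁺ : ∀ d {m} → spine (cdr d) ≤ m → spine d ≤ suc m
≤-cdr⁺ nil     _ = z≤n
≤-cdr⁺ (_ ∙ _) p = s≤s p

nil-reflects : ∀ d → ∃[ r ] Reflects (IsNil d) r
nil-reflects nil     = true , ofʸ refl
nil-reflects (_ ∙ _) = false , ofⁿ λ ()

map-reflects : ∀ {P Q : Set} {r} → (P → Q) → (Q → P) → Reflects P r → Reflects Q r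
map-reflects f g (ofʸ p)  = ofʸ (f p)
map-reflects f g (ofⁿ ¬p) = ofⁿ λ q → ¬p (g q)

-- Correctness and running time of compiled formulas

module Correctness {n} (E : Fin n → Subset n) (I J : Subset n) (u : ℕ) where

  set : Bool → Subset n
  set false = I
  set true  = J

  Sat : ∀ {m} → Formula m → Vec (Fin n) m → Set
  Sat (adj x y) ρ = lookup ρ y ∈ E (lookup ρ x)
  Sat (le x y)  ρ = toℕ (lookup ρ x) ≤ toℕ (lookup ρ y)
  Sat (mem S x) ρ = lookup ρ x ∈ set S
  Sat (card< S) ρ = ∣ set S ∣ < u
  Sat (card≤ S) ρ = ∣ set S ∣ ≤ u
  Sat top       ρ = Unit
  Sat (neg φ)   ρ = ¬ Sat φ ρ
  Sat (and φ ψ) ρ = Sat φ ρ × Sat ψ ρ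
  Sat (or φ ψ)  ρ = Sat φ ρ ⊎ Sat ψ ρ
  Sat (ex φ)    ρ = ∃[ v ] Sat φ (v ∷ ρ)

  M inst : 𝔻
  M    = encodeVec encodeSubset (tabulate E)
  inst = M ∙ encodeSubset I ∙ encodeSubset J ∙ encodeℕᵇ (ℕᵇ.fromℕ u)

  N : ℕ
  N = size inst

  n<N : n < N
  n<N = ℕ.m≤n⇒m≤1+n (ℕ.≤-trans
    (subst (_< size M) (spine-encodeVec encodeSubset (tabulate E)) (spine<size M))
    (ℕ.m≤m+n (size M) _))

  digits≤N : spine (encodeℕᵇ (ℕᵇ.fromℕ u)) ≤ N
  digits≤N = ℕ.m≤n⇒m≤1+n (up M (ℕ.m≤n⇒m≤1+n (up (encodeSubset I) (ℕ.m≤n⇒m≤1+n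
    (up (encodeSubset J) (ℕ.<⇒≤ (spine<size (encodeℕᵇ (ℕᵇ.fromℕ u)))))))))
    where
    up : ∀ d {m k} → m ≤ k → m ≤ size d + k
    up d p = ℕ.≤-trans p (ℕ.m≤n+m _ (size d))

  st : 𝔻 → 𝔻 → 𝔻 → 𝔻 → Store 5
  st e a b c = inst ∷ e ∷ a ∷ b ∷ c ∷ []

  Represents : ∀ {m} → 𝔻 → Vec (Fin n) m → Set
  Represents e []      = Unit
  Represents e (v ∷ ρ) = spine (car e) ≡ suc (toℕ v) × Represents (cdr e) ρ

  nth-spine : ∀ {m} {ρ : Vec (Fin n) m} {s} (e : Expr 5) → Represents (eval e s) ρ → ∀ x →
              spine (eval (nth x e) s) ≡ suc (toℕ (lookup ρ x))
  nth-spine {ρ = _ ∷ _} e (p , _) zero    = p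
  nth-spine {ρ = _ ∷ _} e (_ , r) (suc x) = nth-spine (tl e) r x

  -- The work registers may hold anything at the start and the environment is preserved, so that
  -- commands compose without clean-up.
  Decides : Cmd 5 → Set → 𝔻 → ℕ → Set
  Decides C P e T = ∀ a b c → ∃[ r ] (Reflects P r ×
    ∃[ b′ ] ∃[ c′ ] Run C (st e a b c) (st e (encodeBool r) b′ c′) T)

  answer : ∀ {C} {P : Set} {e a b c d b′ c′ T r} → Reflects P r → d ≡ encodeBool r →
           Run C (st e a b c) (st e d b′ c′) T →
           ∃[ r ] (Reflects P r × ∃[ b′ ] ∃[ c′ ] Run C (st e a b c) (st e (encodeBool r) b′ c′) T)
  answer {r = r} p refl run = r , p , _ , _ , run

  run-drop′ : ∀ a {e b c} →
    ⟨ dropᶜ , st e a b c ⟩⇓ st e nil (cdrs (spine a) b) c in-time (spine a * 8 + 2)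
  run-drop′ nil     = while-false refl
  run-drop′ (_ ∙ a) = while-true refl (seq assign assign) (run-drop′ a)

  run-drop : ∀ a {e b c} → spine a ≤ N →
             Run dropᶜ (st e a b c) (st e nil (cdrs (spine a) b) c) (⟦ dropᵗ ⟧ N)
  run-drop a a≤N = _ , run-drop′ a , ℕ.+-monoˡ-≤ 2 (ℕ.*-monoˡ-≤ 8 a≤N)

  ≤N : ∀ {v : Fin n} {d} → spine d ≡ toℕ v → spine d ≤ N
  ≤N {v} eq = ℕ.≤-trans (ℕ.≤-reflexive eq) (ℕ.≤-trans (ℕ.<⇒≤ (toℕ<n v)) (ℕ.<⇒≤ n<N))

  run-lookup : ∀ {A : Set} (f : A → 𝔻) (xs : Vec A n) v a {e b c} →
               b ≡ encodeVec f xs → spine a ≡ toℕ v →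
               ∃[ b′ ] (Run dropᶜ (st e a b c) (st e nil b′ c) (⟦ dropᵗ ⟧ N) ×
                       car b′ ≡ f (lookup xs v))
  run-lookup f xs v a refl eq = _ , run-drop a (≤N {v} {a} eq) ,
    trans (cong (λ i → car (cdrs i (encodeVec f xs))) eq) (car-cdrs f xs v)

  run-not : ∀ x {e a b c r} → Reflects (IsNil (lookup (st e a b c) x)) r →
            Run (notᶜ (var x)) (st e a b c) (st e (encodeBool r) b c) (⟦ notᵗ ⟧ N)
  run-not x {e} {a} {b} {c} R with lookup (st e a b c) x in eq | R
  ... | nil   | ofʸ _  = run-false eq run-≔
  ... | nil   | ofⁿ ¬p = contradiction refl ¬p
  ... | _ ∙ _ | ofⁿ _  = weaken (ℕ.m≤m+n _ 2) (run-true eq run-≔)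

  run-count : ∀ {m} (S : Subset m) a {e c} → ∃[ a′ ] (spine a′ ≡ ∣ S ∣ + spine a ×
              Run countᶜ (st e a (encodeSubset S) c) (st e a′ nil c) (m * 12 + 2))
  run-count []          a = a , refl , run-stop refl
  run-count {suc m} (true  ∷ S) a with run-count S (nil ∙ a)
  ... | a′ , eq , r = a′ , trans eq (ℕ.+-suc ∣ S ∣ (spine a)) ,
    run-loop 12 m 2 refl (run-true refl run-≔ run-⨾ run-≔) ℕ.≤-refl r
  run-count {suc m} (false ∷ S) a with run-count S a
  ... | a′ , eq , r = a′ , eq ,
    run-loop 12 m 2 refl (run-false refl run-≔ run-⨾ run-≔) (ℕ.m≤n+m 10 2) r

  run-halve : ∀ a c {e b} → ∃[ c′ ] (spine c′ ≡ ⌈ spine a /2⌉ + spine c ×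
              Run halveᶜ (st e a b c) (st e nil b c′) (spine a * 10 + 2))
  run-halve nil             c = c , refl , run-stop refl
  run-halve (_ ∙ nil)       c = nil ∙ c , refl ,
    run-loop 10 0 2 refl (run-≔ run-⨾ run-≔) ℕ.≤-refl (run-stop refl)
  run-halve (_ ∙ (_ ∙ a))   c with run-halve a (nil ∙ c)
  ... | c′ , eq , r = c′ , trans eq (ℕ.+-suc ⌈ spine a /2⌉ (spine c)) ,
    weaken (ℕ.+-monoʳ-≤ 10 (ℕ.m≤n+m _ 10))
      (run-loop 10 (spine a) 2 refl (run-≔ run-⨾ run-≔) ℕ.≤-refl r)

  compareᵗ : ℕ
  compareᵗ = 2 + (7 + (2 + ((N * 10 + 2) + (2 + 3))))

  run-digit : ∀ a {d b c e} → spine a ≤ N → ∃[ a′ ] (spine a′ ≡ ⌈ spine a /2⌉ ×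
    Run (rc ≔ nil ⨾ halveᶜ ⨾ ra ≔ var rc ⨾ rb ≔ tl (var rb))
        (st e a (d ∙ b) c) (st e a′ b a′) (2 + ((N * 10 + 2) + (2 + 3))))
  run-digit a a≤N with run-halve a nil
  ... | a′ , eq , r = a′ , trans eq (ℕ.+-identityʳ _) ,
    (run-≔ run-⨾ weaken (ℕ.+-monoˡ-≤ 2 (ℕ.*-monoˡ-≤ 10 a≤N)) r run-⨾ run-≔ run-⨾ run-≔)

  -- Subtracting a digit and halving never lengthens the counter, so every round obeys the same
  -- bound. Once the digits are used up, only an empty counter passes.
  run-compare : ∀ x a {e c} → spine a ≤ N →
    ∃[ a′ ] ((IsNil a′ → spine a ≤ ℕᵇ.toℕ x) × (spine a ≤ ℕᵇ.toℕ x → IsNil a′) ×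
    ∃[ c′ ] Run compareᶜ (st e a (encodeℕᵇ x) c) (st e a′ nil c′) (spine (encodeℕᵇ x) * compareᵗ + 2))
  run-compare ℕᵇ.zero a {c = c} a≤N = a , (λ { refl → z≤n }) ,
    (λ p → spine-0 (ℕ.n≤0⇒n≡0 p)) , c , run-stop refl
  run-compare 2[1+ x ] a a≤N with run-digit (cdr (cdr a)) (cdr-≤ (cdr a) (cdr-≤ a a≤N))
  ... | a′ , eq , r with run-compare x a′ (ℕ.≤-trans (ℕ.≤-reflexive eq)
                         (ℕ.≤-trans (ℕ.⌈n/2⌉≤n _) (cdr-≤ (cdr a) (cdr-≤ a a≤N))))
  ...   | a″ , f , g , c′ , r′ = a″ ,
    (λ e → subst (spine a ≤_) (sym (ℕ.*-suc 2 (ℕᵇ.toℕ x)))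
      (≤-cdr⁺ a (≤-cdr⁺ (cdr a) (⌈/2⌉-≤⁺ _ _ (subst (_≤ ℕᵇ.toℕ x) eq (f e)))))) ,
    (λ p → g (subst (_≤ ℕᵇ.toℕ x) (sym eq) (⌈/2⌉-≤⁻ _ _ (≤-cdr⁻ (cdr a) (≤-cdr⁻ a
      (subst (spine a ≤_) (ℕ.*-suc 2 (ℕᵇ.toℕ x)) p)))))) ,
    c′ , run-loop compareᵗ (spine (encodeℕᵇ x)) 2 refl (run-true refl run-≔ run-⨾ r) ℕ.≤-refl r′
  run-compare 1+[2 x ] a a≤N with run-digit (cdr a) (cdr-≤ a a≤N)
  ... | a′ , eq , r with run-compare x a′ (ℕ.≤-trans (ℕ.≤-reflexive eq)
                         (ℕ.≤-trans (ℕ.⌈n/2⌉≤n _) (cdr-≤ a a≤N)))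
  ...   | a″ , f , g , c′ , r′ = a″ ,
    (λ e → ≤-cdr⁺ a (⌈/2⌉-≤⁺ _ _ (subst (_≤ ℕᵇ.toℕ x) eq (f e)))) ,
    (λ p → g (subst (_≤ ℕᵇ.toℕ x) (sym eq) (⌈/2⌉-≤⁻ _ _ (≤-cdr⁻ a p)))) ,
    c′ , run-loop compareᵗ (spine (encodeℕᵇ x)) 2 refl (run-false refl run-≔ run-⨾ r) (ℕ.n≤1+n _) r′

  run-set : ∀ S {e a b c} →
    Run (rb ≔ setᵉ S) (st e a b c) (st e a (encodeSubset (set S)) c) (suc (cost (setᵉ S)))
  run-set false = run-≔
  run-set true  = run-≔

  decide-card : ∀ S e₀ j {e} → j ≤ 1 → (∀ s → spine (eval e₀ s) ≡ j) →
                Decides (cardᶜ S e₀) (∣ set S ∣ + j ≤ u) e (⟦ cardᵗ S e₀ ⟧ N)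
  decide-card S e₀ j {e} j≤1 e₀-spine a b c
    with run-count (set S) (eval e₀ (st e a b c))
  ... | a₁ , eq , r₁ with run-compare (ℕᵇ.fromℕ u) a₁
      (ℕ.≤-trans (ℕ.≤-reflexive (trans eq (cong (∣ set S ∣ +_) (e₀-spine _))))
        (ℕ.≤-trans (ℕ.+-mono-≤ (∣p∣≤n (set S)) j≤1)
          (ℕ.≤-trans (ℕ.≤-reflexive (ℕ.+-comm n 1)) n<N)))
  ...   | a₂ , f , g , c₂ , r₂ with nil-reflects a₂
  ...     | r , refl-r = r ,
    map-reflects
      (λ p → subst (λ i → i ≤ u) eq′ (subst (spine a₁ ≤_) (ℕᵇ.toℕ-fromℕ u) (f p)))
      (λ p → g (subst (spine a₁ ≤_) (sym (ℕᵇ.toℕ-fromℕ u)) (subst (λ i → i ≤ u) (sym eq′) p)))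
      refl-r , _ , _ ,
    (run-≔ run-⨾ run-set S
      run-⨾ weaken (ℕ.+-monoˡ-≤ 2 (ℕ.*-monoˡ-≤ 12 (ℕ.<⇒≤ n<N))) r₁
      run-⨾ run-≔
      run-⨾ weaken (ℕ.+-monoˡ-≤ 2 (ℕ.*-monoˡ-≤ compareᵗ digits≤N)) r₂
      run-⨾ run-not ra refl-r)
    where
    eq′ : spine a₁ ≡ ∣ set S ∣ + j
    eq′ = trans eq (cong (∣ set S ∣ +_) (e₀-spine _))

  module _ {C : Cmd 5} {Q : Fin n → Set} {e : 𝔻} {T : ℕ}
           (decide : ∀ d v → spine d ≡ suc (toℕ v) → Decides C (Q v) (d ∙ e) T) where

    -- The invariant is that all vertices from the length of the numeral upwards have failed. The
    -- numeral `x ∙ d` stands for the vertex `spine d`, which is the next one to try.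
    run-ex : ∀ d {b c} → spine d ≤ n → (∀ v → spine d ≤ toℕ v → ¬ Q v) →
             ∃[ r ] (Reflects (∃[ v ] Q v) r × ∃[ b′ ] ∃[ c′ ]
             Run (exᶜ C) (st (d ∙ e) nil b c) (st (nil ∙ e) (encodeBool r) b′ c′)
                 (spine d * (3 + (T + 9)) + 3))
    run-ex nil {b} {c} _ none = false , ofⁿ (λ (v , q) → none v z≤n q) , b , c , run-stop refl
    run-ex (x ∙ d) {b} {c} d<n none
      with decide (x ∙ d) (fromℕ< d<n) (cong suc (sym (toℕ-fromℕ< d<n))) nil b c
    ... | true , ofʸ q , b′ , c′ , r = true , ofʸ (_ , q) , b′ , c′ ,
      run-loop (3 + (T + 9)) (spine d) 3 refl (r run-⨾ run-true refl run-≔) T+7≤T+9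
        (weaken (ℕ.m≤n+m 3 _) (run-stop refl))
      where
      T+7≤T+9 : 3 + (T + 7) ≤ 3 + (T + 9)
      T+7≤T+9 = ℕ.+-monoʳ-≤ 3 (ℕ.+-monoʳ-≤ T (ℕ.m≤m+n 7 2))
    ... | false , ofⁿ ¬q , b′ , c′ , r
      with run-ex d {b′} {c′} (ℕ.<⇒≤ d<n) none′
      where
      none′ : ∀ v → spine d ≤ toℕ v → ¬ Q v
      none′ v d≤v q with ℕ.m≤n⇒m<n∨m≡n d≤v
      ... | inj₁ d<v = none v d<v q
      ... | inj₂ d≡v = ¬q (subst Q (toℕ-injective (trans (sym d≡v) (sym (toℕ-fromℕ< d<n)))) q)
    ...   | r′ , R , b″ , c″ , run = r′ , R , b″ , c″ ,
      run-loop (3 + (T + 9)) (spine d) 3 refl (r run-⨾ run-false refl run-≔) ℕ.≤-refl run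

  spine-tl-nth : ∀ {m} {ρ : Vec (Fin n) m} {s} x → Represents (eval (var re) s) ρ →
                  spine (eval (tl (nth x (var re))) s) ≡ toℕ (lookup ρ x)
  spine-tl-nth {s = s} x rep =
    trans (spine-cdr (eval (nth x (var re)) s)) (cong pred (nth-spine (var re) rep x))

  decide : ∀ {m} (φ : Formula m) {ρ e} → Represents e ρ →
           Decides (compile φ) (Sat φ ρ) e (⟦ time φ ⟧ N)
  decide (adj x y) {ρ} {e} rep a b c
    with run-lookup encodeSubset (tabulate E) (lookup ρ x) (eval (tl (nth x (var re))) (st e a b c))
           {c = c} refl (spine-tl-nth x rep)
  ... | b₁ , r₁ , eq₁
    with run-lookup encodeBool (E (lookup ρ x)) (lookup ρ y)
           (eval (tl (nth y (var re))) (st e nil (car b₁) c))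
           {c = c} (trans eq₁ (cong encodeSubset (lookup∘tabulate E (lookup ρ x)))) (spine-tl-nth y rep)
  ... | b₂ , r₂ , eq₂ = answer (∈-reflects (lookup ρ y) (E (lookup ρ x))) eq₂
    (run-≔ run-⨾ run-≔ run-⨾ r₁ run-⨾ run-≔ run-⨾ run-≔ run-⨾ r₂ run-⨾ run-≔)
  decide (le x y)  {ρ} {e} rep a b c with nil-reflects (cdrs (spine Y) X′)
    where
    Y X′ : 𝔻
    Y = eval (nth y (var re)) (st e a b c)
    X′ = eval (nth x (var re)) (st e Y b c)
  ... | r , R = r , map-reflects
      (λ p → ℕ.m∸n≡0⇒m≤n (trans (sym eq) (cong spine p)))
      (λ p → spine-0 (trans eq (ℕ.m≤n⇒m∸n≡0 p))) R , _ , _ ,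
    (run-≔ run-⨾ run-≔ run-⨾
     run-drop Y (ℕ.≤-trans (ℕ.≤-reflexive (nth-spine (var re) rep y))
       (ℕ.≤-trans (toℕ<n (lookup ρ y)) (ℕ.<⇒≤ n<N)))
     run-⨾ run-not rb R)
    where
    Y X′ : 𝔻
    Y = eval (nth y (var re)) (st e a b c)
    X′ = eval (nth x (var re)) (st e Y b c)
    eq : spine (cdrs (spine Y) X′) ≡ toℕ (lookup ρ x) ∸ toℕ (lookup ρ y)
    eq = trans (spine-cdrs (spine Y) X′)
      (cong₂ _∸_ (nth-spine (var re) rep x) (nth-spine (var re) rep y))
  decide (mem S x) {ρ} {e} rep a b c
    with run-lookup encodeBool (set S) (lookup ρ x) (eval (tl (nth x (var re))) (st e a b c))
           {c = c} refl (spine-tl-nth x rep)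
  ... | b₁ , r₁ , eq₁ = answer (∈-reflects (lookup ρ x) (set S)) eq₁
    (run-≔ run-⨾ run-set S run-⨾ r₁ run-⨾ run-≔)
  decide (card< S) {e = e} rep =
    subst (λ i → Decides (compile {0} (card< S)) (i ≤ u) e (⟦ cardᵗ S yesᵉ ⟧ N)) (ℕ.+-comm ∣ set S ∣ 1)
      (decide-card S yesᵉ 1 ℕ.≤-refl (λ _ → refl))
  decide (card≤ S) {e = e} rep =
    subst (λ i → Decides (compile {0} (card≤ S)) (i ≤ u) e (⟦ cardᵗ S nil ⟧ N)) (ℕ.+-identityʳ ∣ set S ∣)
      (decide-card S nil 0 z≤n (λ _ → refl))
  decide top       rep a b c = true , ofʸ tt , b , c , run-≔
  decide (neg φ)   rep a b c with decide φ rep a b c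
  ... | true  , R , b′ , c′ , r = false , ¬-reflects R , b′ , c′ ,
    (r run-⨾ run-not ra (ofⁿ λ ()))
  ... | false , R , b′ , c′ , r = true , ¬-reflects R , b′ , c′ ,
    (r run-⨾ run-not ra (ofʸ refl))
  decide (and φ ψ) rep a b c with decide φ rep a b c
  ... | false , ofⁿ ¬p , b′ , c′ , r = false , ofⁿ (λ (p , _) → ¬p p) , b′ , c′ ,
    (r run-⨾ run-false refl (weaken (ℕ.m≤n+m 2 _) run-≔))
  ... | true  , R , b′ , c′ , r with decide ψ rep (encodeBool true) b′ c′
  ...   | s , R′ , b″ , c″ , r′ = s , (R ×-reflects R′) , b″ , c″ ,
    (r run-⨾ run-true refl (weaken (ℕ.m≤m+n _ 2) r′))
  decide (or φ ψ)  rep a b c with decide φ rep a b c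
  ... | true  , ofʸ p , b′ , c′ , r = true , ofʸ (inj₁ p) , b′ , c′ ,
    (r run-⨾ run-true refl (weaken (ℕ.m≤n+m 4 _) run-≔))
  ... | false , R , b′ , c′ , r with decide ψ rep (encodeBool false) b′ c′
  ...   | s , R′ , b″ , c″ , r′ = s , (R ⊎-reflects R′) , b″ , c″ ,
    (r run-⨾ run-false refl (weaken (ℕ.m≤m+n _ 4) r′))
  decide (ex φ)    {ρ} {e} rep a b c
    -- The matrix has `n` rows, so the invariant holds vacuously at the start.
    with run-ex {C = compile φ} {Q = λ v → Sat φ (v ∷ ρ)} (λ d v eq → decide φ (eq , rep)) M
           {b} {c} (ℕ.≤-reflexive spine-M)
           (λ v n≤v → contradiction (toℕ<n v) (ℕ.≤⇒≯ (subst (_≤ toℕ v) spine-M n≤v)))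
    where
    spine-M : spine M ≡ n
    spine-M = spine-encodeVec encodeSubset (tabulate E)
  ... | s , R , b′ , c′ , r = s , R , b′ , c′ ,
    (run-≔ run-⨾ run-≔ run-⨾ weaken (ℕ.+-monoˡ-≤ 3 (ℕ.*-monoˡ-≤ _ M≤N)) r run-⨾ run-≔)
    where
    M≤N : spine M ≤ N
    M≤N = ℕ.≤-trans (ℕ.≤-reflexive (spine-encodeVec encodeSubset (tabulate E))) (ℕ.<⇒≤ n<N)

-- The criterion as a first-order formula

∃-⇔ : ∀ {A : Set} {P Q : A → Set} → (∀ x → P x ⇔ Q x) → (∃[ x ] P x) ⇔ (∃[ x ] Q x)
∃-⇔ e = mk⇔ (λ (x , p) → x , to (e x) p) (λ (x , q) → x , from (e x) q)

exs : ∀ k {m} → Formula (k + m) → Formula m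
exs zero    φ = φ
exs (suc k) φ = exs k (ex φ)

eqᶠ : ∀ {m} → Fin m → Fin m → Formula m
eqᶠ x y = and (le x y) (le y x)

allᶠ : ∀ {m k} → (Fin m → Formula m) → Vec (Fin m) k → Formula m
allᶠ φ []       = top
allᶠ φ (x ∷ xs) = and (φ x) (allᶠ φ xs)

linkedᶠ uniqueᶠ : ∀ {m k} → Vec (Fin m) k → Formula m
linkedᶠ []           = top
linkedᶠ (x ∷ [])     = top
linkedᶠ (x ∷ y ∷ xs) = and (adj x y) (linkedᶠ (y ∷ xs))
uniqueᶠ []           = top
uniqueᶠ (x ∷ xs)     = and (allᶠ (λ y → neg (eqᶠ x y)) xs) (uniqueᶠ xs)

names : ∀ k {m} → Vec (Fin (k + m)) k
names k = tabulate (_↑ˡ _)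

sameᶠ : Formula 0
sameᶠ = neg (ex (or (and (mem false zero) (neg (mem true zero)))
                    (and (mem true zero) (neg (mem false zero)))))

missᶠ : ∀ k → Bool → Fin (k + 1) → Formula (k + 1)
missᶠ k S x = neg (and (mem S x) (neg (eqᶠ x (k ↑ʳ zero))))

-- The path occupies the variables below k; variable k is the vertex left out of
-- the cover.
avoidingᶠ : ∀ k → Bool → Formula (k + 1)
avoidingᶠ k S = and (and (linkedᶠ (names k)) (uniqueᶠ (names k))) (allᶠ (missᶠ k S) (names k))

redundantᶠ : ℕ → Bool → Formula 1
redundantᶠ k S = and (mem S zero) (neg (exs k (avoidingᶠ k S)))

mobileᶠ : ℕ → Bool → Formula 0
mobileᶠ k S = or (card< S) (ex (redundantᶠ k S))

criterionᶠ : ℕ → Formula 0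
criterionᶠ k = and (card≤ false) (and (card≤ true) (or sameᶠ (and (mobileᶠ k false) (mobileᶠ k true))))

names-lookup : ∀ {A : Set} {k m} (p : Vec A k) (ρ : Vec A m) → map (lookup (p ++ ρ)) (names k) ≡ p
names-lookup p ρ = trans (sym (tabulate-∘ (lookup (p ++ ρ)) (_↑ˡ _)))
  (trans (tabulate-cong (lookup-++ˡ p ρ)) (tabulate∘lookup p))

module _ {n} (G : Graph n) (I J : Subset n) (u : ℕ) where
  open Graph G using (N; IsPath; _~_)
  open Correctness N I J u

  sat-exs : ∀ k {m} (φ : Formula (k + m)) ρ → Sat (exs k φ) ρ ⇔ (∃[ p ] Sat φ (p ++ ρ))
  sat-exs zero    φ ρ = mk⇔ ([] ,_) λ { ([] , s) → s }
  sat-exs (suc k) φ ρ = ⇔-trans (sat-exs k (ex φ) ρ)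
    (mk⇔ (λ (p , v , s) → v ∷ p , s) λ { (v ∷ p , s) → p , v , s })

  module _ {m} (ρ : Vec (Fin n) m) where

    sat-eq : ∀ x y → Sat (eqᶠ x y) ρ ⇔ (lookup ρ x ≡ lookup ρ y)
    sat-eq x y = mk⇔ (λ (p , q) → toℕ-injective (ℕ.≤-antisym p q))
      λ e → ℕ.≤-reflexive (cong toℕ e) , ℕ.≤-reflexive (cong toℕ (sym e))

    sat-all : ∀ {φ} {P : Fin n → Set} → (∀ x → Sat (φ x) ρ ⇔ P (lookup ρ x)) →
              ∀ {k} (xs : Vec (Fin m) k) → Sat (allᶠ φ xs) ρ ⇔ All P (map (lookup ρ) xs)
    sat-all e []       = mk⇔ (λ _ → []) (λ _ → tt)
    sat-all e (x ∷ xs) = ⇔-trans (e x ×-⇔ sat-all e xs) (mk⇔ (λ (p , q) → p ∷ q) All.uncons)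

    sat-linked : ∀ {k} (xs : Vec (Fin m) k) → Sat (linkedᶠ xs) ρ ⇔ Linked _~_ (map (lookup ρ) xs)
    sat-linked []           = mk⇔ (λ _ → []) (λ _ → tt)
    sat-linked (x ∷ [])     = mk⇔ (λ _ → [-]) (λ _ → tt)
    sat-linked (x ∷ y ∷ xs) = ⇔-trans (⇔-refl ×-⇔ sat-linked (y ∷ xs))
      (mk⇔ (λ (p , q) → p ∷ q) (λ { (p ∷ q) → p , q }))

    sat-unique : ∀ {k} (xs : Vec (Fin m) k) → Sat (uniqueᶠ xs) ρ ⇔ Unique (map (lookup ρ) xs)
    sat-unique []       = mk⇔ (λ _ → []) (λ _ → tt)
    sat-unique (x ∷ xs) = ⇔-trans (sat-all (λ y → ¬-cong-⇔ (sat-eq x y)) xs ×-⇔ sat-unique xs)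
      (mk⇔ (λ (p , q) → p ∷ q) (λ { (p ∷ q) → p , q }))

  sat-same : Sat sameᶠ [] ⇔ (I ≡ J)
  sat-same = mk⇔
    (λ ¬d → ⊆-antisym
      (λ {v} v∈I → decidable-stable (v ∈? J) λ v∉J → ¬d (v , inj₁ (v∈I , v∉J)))
      (λ {v} v∈J → decidable-stable (v ∈? I) λ v∉I → ¬d (v , inj₂ (v∈J , v∉I))))
    λ { refl (v , inj₁ (a , b)) → b a ; refl (v , inj₂ (a , b)) → b a }

  module _ (k : ℕ) where

    module _ (S : Bool) where

      Hit : Fin n → Fin n → Set
      Hit v x = x ∈ set S × x ≢ v

      Avoiding : Fin n → Vec (Fin n) k → Set
      Avoiding v p = IsPath p × All (λ x → ¬ Hit v x) p

      sat-avoiding : ∀ v (p : Vec (Fin n) k) → Sat (avoidingᶠ k S) (p ++ v ∷ []) ⇔ Avoiding v p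
      sat-avoiding v p = subst (λ q → Sat (avoidingᶠ k S) ρ ⇔ Avoiding v q) (names-lookup p (v ∷ []))
        ((sat-linked ρ (names k) ×-⇔ sat-unique ρ (names k)) ×-⇔ sat-all ρ misses (names k))
        where
        ρ : Vec (Fin n) (k + 1)
        ρ = p ++ v ∷ []
        misses : ∀ x → Sat (missᶠ k S x) ρ ⇔ (¬ Hit v (lookup ρ x))
        misses x = ¬-cong-⇔ (⇔-refl ×-⇔ ¬-cong-⇔
          (subst (λ w → Sat (eqᶠ x (k ↑ʳ zero)) ρ ⇔ (lookup ρ x ≡ w)) (lookup-++ʳ p (v ∷ []) zero)
            (sat-eq ρ x (k ↑ʳ zero))))

      -- Being hit is decidable for a given path, so the double negation that comes from expressing
      -- the universal quantifier through `ex` can be removed.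
      stable : ∀ v → (¬ (∃[ p ] Avoiding v p)) ⇔ (∀ p → IsPath p → Any (Hit v) p)
      stable v = mk⇔
        (λ ¬p p isPath → decidable-stable (Any.any? (λ x → (x ∈? set S) ×-dec ¬? (x ≟ v)) p)
           λ ¬a → ¬p (p , isPath , ¬Any⇒All¬ p ¬a))
        (λ hit (p , isPath , avoid) → let (¬h , h) = All.lookupAny avoid (hit p isPath) in ¬h h)

      sat-redundant : ∀ v → Sat (redundantᶠ k S) (v ∷ []) ⇔
                      (v ∈ set S × (∀ p → IsPath p → Any (Hit v) p))
      sat-redundant v = ⇔-refl ×-⇔ ⇔-trans
        (¬-cong-⇔ (⇔-trans (sat-exs k (avoidingᶠ k S) (v ∷ [])) (∃-⇔ (sat-avoiding v)))) (stable v)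

      sat-mobile : Sat (mobileᶠ k S) [] ⇔ Mobile G k u (set S)
      sat-mobile = ⇔-refl ⊎-⇔ ∃-⇔ sat-redundant

    sat-criterion : Sat (criterionᶠ k) [] ⇔ Criterion G k u I J
    sat-criterion = ⇔-refl ×-⇔ ⇔-refl ×-⇔ (sat-same ⊎-⇔ (sat-mobile false ×-⇔ sat-mobile true))

-- The formula is chosen before the instance, so its compilation is a single program and `time φ` a
-- single polynomial.
definable⇒polynomialTime : ∀ {k} {P : Instance k → Set} (φ : Formula 0) →
  (∀ x → let open Instance x in Correctness.Sat (Graph.N T) I J u φ [] ⇔ P x) →
  DecidableInPolynomialTime (Instance k) encodeInstance P
-- The extra 2 pays for copying the truth value into the output variable.
definable⇒polynomialTime φ correct with monomial-bound (time φ ⊕ con 2)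
... | c , d , bound =
  program 4 (compile φ ⨾ rg ≔ var ra) , c , d , λ x →
    let open Instance x
        module M = Correctness (Graph.N T) I J u
        (answer , reflects , _ , _ , run) = M.decide φ {ρ = []} tt nil nil nil
        (t , runs , t≤) = run run-⨾ run-≔
    in answer , t , (_ , runs , refl) ,
       map-reflects (to (correct x)) (from (correct x)) reflects ,
       ℕ.≤-trans t≤ (ℕ.≤-trans (bound (s≤s z≤n)) (ℕ.m≤m+n _ c))

theorem4 : (k : ℕ) → 2 ≤ k →
    DecidableInPolynomialTime (Instance k) encodeInstance
    (λ x → let open Instance x in TAR-Reconfigurable k T u I J)
theorem4 k 2≤k = definable⇒polynomialTime (criterionᶠ k) λ x →
  let open Instance x in
  ⇔-trans (sat-criterion T I J u k)
    (mk⇔ (criterion-sound T k u (ℕ.≤-trans (s≤s z≤n) 2≤k) (IsTree.acyclic T-tree) I-cover J-cover)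
         (criterion-complete T k u))
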